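{- Let $e\ge 3$ be an odd integer, $q=2^e$, and let $\mathcal{C}^3_\varepsilon:=\mathcal{C}(\mathcal{V}^3_\varepsilon)$ be the code over $\mathbb{F}_{q^2}$ generated by the point set $\mathcal{V}^3_\varepsilon\subset\mathrm{PG}(3,q^2)$ (defined in the context, with $r=3$). Then $\mathcal{C}^3_\varepsilon$ is a minimal linear code if and only if $e\equiv 3\pmod 4$.
   Context: Let $e\ge 3$ be odd, $q=2^e$, $r\ge 2$. Points of $\mathrm{PG}(r,q^2)$ (projective space of projective dimension $r$ over $\mathbb{F}_{q^2}$) have homogeneous coordinates $(X_0,\dots,X_r)$; $\Pi_\infty$ is the hyperplane $X_0=0$, and affine coordinates on the complement $\mathrm{AG}(r,q^2)$ are $x_i=X_i/X_0$. For an exponent involving $\sigma$, $\sigma$ stands for $2^{(e+1)/2}$, i.e. $x^{\sigma}=x^{2^{(e+1)/2}}$ and $x^{\sigma+2}=x^{2^{(e+1)/2}+2}$. Fix $\varepsilon\in\mathbb{F}_{q^2}\setminus\mathbb{F}_q$ such that $\varepsilon^2+\varepsilon+\delta=0$ for some $\delta\in\mathbb{F}_q\setminus\{1\}$ with absolute trace $\mathrm{Tr}_{q/2}(\delta)=\sum_{i=0}^{e-1}\delta^{2^i}=1$. Put $$\Gamma_{\varepsilon}(x)=[x+(x^q+x)\varepsilon]^{\sigma+2}+(x^q+x)^{\sigma}+(x^{2q}+x^2)\varepsilon+x^{q+1}+x^2.$$ $\mathcal{V}^r_\varepsilon$ is the projective hypersurface of $\mathrm{PG}(r,q^2)$ with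 affine equation $x_r^q+x_r=\Gamma_{\varepsilon}(x_1)+\dots+\Gamma_{\varepsilon}(x_{r-1})$, i.e. the zero locus of the homogenization (with respect to $X_0$) of the corresponding polynomial; it is identified with its set of $\mathbb{F}_{q^2}$-rational points. For a set $\Omega$ of $N$ points of $\mathrm{PG}(r,q^2)$, $\mathcal{C}(\Omega)$ is the linear code of length $N$ over $\mathbb{F}_{q^2}$ spanned by the rows of an $(r+1)\times N$ matrix whose columns are coordinate vectors of the points of $\Omega$ (one representative per point); it is unique up to monomial equivalence. The support of a codeword $c=(c_1,\dots,c_N)$ is $\mathrm{supp}(c)=\{i: c_i\ne 0\}$. A codeword $c\in\mathcal{C}$ is minimal if every non-zero codeword $c'\in\mathcal{C}$ with $\mathrm{supp}(c')\subseteq\mathrm{supp}(c)$ is a scalar multiple of $c$. A linear code is minimal if all its non-zero codewords are minimal. -}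

module Defs where

open import Level using (Level)
open import Algebra.Bundles using (RawRing; Semiring; CommutativeRing)
open import Algebra.Definitions using (Invertible)
import Algebra.Definitions.RawSemiring as RawSemiringDefs
open import Data.Bool.Base using (if_then_else_)
open import Data.Fin.Base using (Fin; toℕ; fromℕ; inject₁)
import Data.Fin.Properties as Fin
open import Data.List.Base as List using (List; []; _∷_; _++_)
open import Data.Nat.Base as ℕ using (ℕ)
import Data.Nat.Properties as ℕ
open import Data.Nat.DivMod using (_/_)
open import Data.Product.Base using (Σ-syntax; ∃-syntax; _×_; _,_)
open import Data.Vec.Base as Vec using (Vec; []; _∷_)
import Data.Vec.Properties as Vec
open import Data.Vec.Functional using (Vector; head; tail)
open import Function.Bundles using (Inverse)
open import Function.Properties.Inverse using (Inverse⇒Injection)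
open import Relation.Binary.Definitions using (Decidable)
open import Relation.Binary.PropositionalEquality as ≡ using (_≡_)
open import Relation.Nullary using (¬_; does)
open import Relation.Nullary.Decidable using (via-injection)
open import Relation.Unary using (Pred; _∈_; _⊆_)

private variable
  c ℓ : Level
  m n r N : ℕ

record FiniteField (c ℓ : Level) (card : ℕ) : Set (Level.suc (c Level.⊔ ℓ)) where
  field
    commutativeRing : CommutativeRing c ℓ
  open CommutativeRing commutativeRing public
  field
    1≉0        : 1# ≉ 0#
    invertible : ∀ x → x ≉ 0# → Invertible _≈_ 1# _*_ x
    enumerate  : Inverse setoid (≡.setoid (Fin card))

  infix 4 _≈?_
  _≈?_ : Decidable _≈_
  _≈?_ = via-injection (Inverse⇒Injection enumerate) Fin._≟_

  open RawSemiringDefs (Semiring.rawSemiring semiring) public using (_^_; sum)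

  -- If card is q², the subfield of order q is the fixed field of the
  -- q-power Frobenius automorphism.
  InSubfield : ℕ → Pred Carrier ℓ
  InSubfield q x = x ^ q ≈ x

  -- The trace from the field of order 2ᵉ down to its prime field.
  absTrace : ℕ → Carrier → Carrier
  absTrace e x = sum {e} (λ i → x ^ (2 ℕ.^ toℕ i))

  infix 4 _≋_ _≋̸_
  _≋_ _≋̸_ : Vector Carrier n → Vector Carrier n → Set ℓ
  u ≋ v = ∀ i → u i ≈ v i
  u ≋̸ v = ¬ (u ≋ v)

  𝟎 : Vector Carrier n
  𝟎 _ = 0#

  infixr 7 _•_
  _•_ : Carrier → Vector Carrier n → Vector Carrier n
  (a • v) i = a * v i

module Polynomials {card : ℕ} (K : FiniteField c ℓ card) where
  open FiniteField K

  Monomial : ℕ → Set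
  Monomial n = Vec ℕ n

  -- A finite formal sum of terms: a monomial may be repeated and coefficients
  -- may vanish, so everything of mathematical meaning goes through coeff.
  Poly : ℕ → Set c
  Poly n = List (Carrier × Monomial n)

  coeff : Poly n → Monomial n → Carrier
  coeff []            μ = 0#
  coeff ((a , ν) ∷ p) μ =
    if does (Vec.≡-dec ℕ._≟_ ν μ) then a + coeff p μ else coeff p μ

  con : Carrier → Poly n
  con a = (a , Vec.replicate _ 0) ∷ []

  var : Fin n → Poly n
  var i = (1# , Vec.updateAt (Vec.replicate _ 0) i ℕ.suc) ∷ []

  mulTerm : Carrier × Monomial n → Carrier × Monomial n → Carrier × Monomial n
  mulTerm (a , μ) (b , ν) = a * b , Vec.zipWith ℕ._+_ μ ν

  polyRing : ℕ → RawRing c ℓ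
  polyRing n = record
    { Carrier = Poly n
    ; _≈_     = λ p s → ∀ μ → coeff p μ ≈ coeff s μ
    ; _+_     = _++_
    ; _*_     = List.cartesianProductWith mulTerm
    ; -_      = List.map (λ (a , μ) → - a , μ)
    ; 0#      = []
    ; 1#      = con 1#
    }

  -- Total degree; the zero polynomial gets degree 0.
  degree : Poly n → ℕ
  degree p = List.foldr
    (λ (_ , μ) d → if does (coeff p μ ≈? 0#) then d else Vec.sum μ ℕ.⊔ d) 0 p

  -- The new variable is the one of index zero.  Terms whose degree exceeds
  -- degree p belong to monomials with coefficient zero; all terms of such a
  -- monomial are sent to the same monomial, so they still cancel.
  homogenize : Poly n → Poly (ℕ.suc n)
  homogenize p = List.map (λ (a , μ) → a , (degree p ℕ.∸ Vec.sum μ) ∷ μ) p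

  evalMonomial : Monomial n → Vector Carrier n → Carrier
  evalMonomial []      x = 1#
  evalMonomial (k ∷ μ) x = head x ^ k * evalMonomial μ (tail x)

  eval : Poly n → Vector Carrier n → Carrier
  eval p x = List.foldr (λ (a , μ) y → a * evalMonomial μ x + y) 0# p

module Projective {card : ℕ} (K : FiniteField c ℓ card) where
  open FiniteField K
  open Polynomials K

  -- Homogeneous coordinate vectors; they denote the same point of PG(r, K)
  -- when related by _∼_.
  record Point (r : ℕ) : Set (c Level.⊔ ℓ) where
    field
      coords  : Vector Carrier (ℕ.suc r)
      nonzero : coords ≋̸ 𝟎
  open Point public

  infix 4 _∼_
  _∼_ : Point r → Point r → Set (c Level.⊔ ℓ)
  P ∼ Q = ∃[ a ] a ≉ 0# × coords P ≋ a • coords Q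

  -- The rational points of the projective closure of the affine hypersurface
  -- f = 0, with X₀ as the homogenizing coordinate.
  hypersurface : Poly r → Pred (Point r) ℓ
  hypersurface f P = eval (homogenize f) (coords P) ≈ 0#

  record Representatives (Ω : Pred (Point r) ℓ) (P : Fin N → Point r)
         : Set (c Level.⊔ ℓ) where
    field
      sound    : ∀ j → P j ∈ Ω
      distinct : ∀ i j → P i ∼ P j → i ≡ j
      complete : ∀ Q → Q ∈ Ω → ∃[ j ] Q ∼ P j

module Codes {card : ℕ} (K : FiniteField c ℓ card) where
  open FiniteField K

  Code : ℕ → Set (Level.suc (c Level.⊔ ℓ))
  Code N = Pred (Vector Carrier N) (c Level.⊔ ℓ)

  rowSpan : (Fin m → Vector Carrier N) → Code N
  rowSpan {m = m} G w =
    Σ[ a ∈ Vector Carrier m ] w ≋ (λ j → sum (λ i → a i * G i j))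

  supp : Vector Carrier N → Pred (Fin N) ℓ
  supp w i = w i ≉ 0#

  IsMinimalWord : Code N → Vector Carrier N → Set (c Level.⊔ ℓ)
  IsMinimalWord C w =
    ∀ w′ → w′ ∈ C → w′ ≋̸ 𝟎 → supp w′ ⊆ supp w → ∃[ a ] w′ ≋ a • w

  IsMinimalCode : Code N → Set (c Level.⊔ ℓ)
  IsMinimalCode C = ∀ w → w ∈ C → w ≋̸ 𝟎 → IsMinimalWord C w

  open Projective K using (Point; coords)

  pointCode : (Fin N → Point r) → Code N
  pointCode P = rowSpan (λ i j → coords (P j) i)

-- Over an arbitrary raw ring, so that it can be applied to polynomials.
module _ (R : RawRing c ℓ) where
  open RawRing R
  open RawSemiringDefs rawSemiring using (_^_)

  Γ : (q σ : ℕ) (ε x : Carrier) → Carrier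
  Γ q σ ε x = (x + (x ^ q + x) * ε) ^ (σ ℕ.+ 2) + (x ^ q + x) ^ σ
            + (x ^ (2 ℕ.* q) + x ^ 2) * ε + x ^ (q ℕ.+ 1) + x ^ 2

module Variety {card : ℕ} (K : FiniteField c ℓ card) (e : ℕ) where
  open FiniteField K using (Carrier)
  open Polynomials K
  open Projective K

  private
    q σ : ℕ
    q = 2 ℕ.^ e
    σ = 2 ℕ.^ ((e ℕ.+ 1) / 2)

  -- Here r = suc k; the affine coordinates x₁, …, x_r have indices 0, …, k.
  affineEquation : (k : ℕ) → Carrier → Poly (ℕ.suc k)
  affineEquation k ε =
    (var (fromℕ k) ^ q + var (fromℕ k))
      - sum (λ (i : Fin k) → Γ R q σ (con ε) (var (inject₁ i)))
    where
    R = polyRing (ℕ.suc k)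
    open RawRing R using (_+_; -_)
    open RawSemiringDefs (RawRing.rawSemiring R) using (_^_; sum)
    infixl 6 _-_
    _-_ : Poly (ℕ.suc k) → Poly (ℕ.suc k) → Poly (ℕ.suc k)
    p - s = p + (- s)

  𝒱 : (k : ℕ) → Carrier → Pred (Point (ℕ.suc k)) ℓ
  𝒱 k ε = hypersurface (affineEquation k ε)

-- Write x = s + tε with s, t in the subfield of order q; then
-- Γ_ε(x) = s^(σ+2) + st + t^σ, and the section of the surface by Π∞ is
-- X₁^(σ+2) = X₂^(σ+2).  The code is minimal as soon as every plane is spanned
-- by the points of the surface it contains.
-- If e ≡ 1 (mod 4), then x ↦ x^(σ+2) is injective, the section at infinity is
-- the single line X₁ = X₂, and the word X₁ + X₂ is supported inside X₀.
-- If e ≡ 3 (mod 4), then 3 divides σ + 2, and since Tr(δ) = 1 the field contains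
-- a primitive cube root of unity ω, so the section at infinity contains lines
-- X₁ = X₂ and X₁ = ωX₂ through (0,0,0,1).  These span Π∞.  A plane through
-- (0,0,0,1) other than Π∞ contains that point and affine points of the surface
-- over every point of a line of the (x₁, x₂)-plane; any other plane meets the
-- two lines at infinity in two points and contains an affine point as well.

module Submission where

open import Defs
open import Level using (Level; _⊔_)
open import Algebra.Bundles using (CommutativeMonoid; CommutativeRing; RawRing)
import Algebra.Definitions.RawSemiring as RawSemiringDefs
import Algebra.Properties.CommutativeMonoid.Sum as CMSum
import Algebra.Properties.CommutativeSemigroup as CommutativeSemigroupProps
import Algebra.Properties.CommutativeSemiring.Exp as Exp
import Algebra.Properties.Monoid.Mult as MonoidMult
import Algebra.Properties.Ring as RingProps
import Algebra.Properties.Semiring.Mult as Mult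
import Algebra.Solver.Ring as RingSolver
import Algebra.Solver.Ring.AlmostCommutativeRing as ACR
open import Data.Bool.Base using (Bool; true; false; _xor_; _∧_; if_then_else_)
open import Data.Fin.Base using (Fin; zero; suc; toℕ; fromℕ; inject₁; punchIn)
open import Data.Fin.Patterns using (0F; 1F; 2F; 3F)
open import Data.Fin.Permutation using (Permutation; permutation)
import Data.Fin.Properties as Fin
open import Data.List.Base as List using (List; []; _∷_; _++_)
open import Data.List.Relation.Unary.All as All using (All; []; _∷_)
import Data.List.Relation.Unary.All.Properties as All
open import Data.List.Relation.Unary.Any using (Any; here; there)
open import Data.Maybe.Base using (Maybe; just; nothing)
open import Data.Nat.Base as ℕ using (ℕ; zero; suc)
open import Data.Nat.DivMod using (_/_; _%_; m≡m%n+[m/n]*n; m*n/n≡m; m%n<n; [m+kn]%n≡m%n)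
import Data.Nat.Properties as ℕ
open import Data.Nat.Solver using (module +-*-Solver)
open import Data.Product.Base using (∃-syntax; _×_; _,_; proj₁; proj₂)
open import Data.Sum.Base using (_⊎_; inj₁; inj₂)
open import Data.Vec.Base as Vec using (Vec; []; _∷_)
import Data.Vec.Properties as Vec
open import Data.Vec.Functional as Vector using (Vector; head; tail; replicate; removeAt)
open import Function.Base using (_∘_; id)
open import Function.Bundles using (_⇔_; mk⇔; Inverse)
open import Relation.Binary.PropositionalEquality as ≡ using (_≡_; _≢_)
import Relation.Binary.Reasoning.Setoid as SetoidReasoning
open import Relation.Nullary using (¬_; yes; no; does)
open import Relation.Nullary.Decidable using (dec-true; dec-false; decidable-stable)
open import Relation.Nullary.Negation using (contradiction)

private variable
  c ℓ : Level

-- Arithmetic of finite fields: cancellation, powers, characteristic, Fermat's little theorem.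

module FieldProperties {card : ℕ} (K : FiniteField c ℓ card) where
  open FiniteField K hiding (zero)
  open SetoidReasoning setoid
  open Exp commutativeSemiring public
    using (^-congˡ; ^-congʳ; ^-homo-*; ^-assocʳ; ^-distrib-*)

  inv : ∀ {x} → x ≉ 0# → Carrier
  inv {x} x≉0 = proj₁ (invertible x x≉0)

  inv-inverseˡ : ∀ {x} (x≉0 : x ≉ 0#) → inv x≉0 * x ≈ 1#
  inv-inverseˡ {x} x≉0 = proj₁ (proj₂ (invertible x x≉0))

  inv-inverseʳ : ∀ {x} (x≉0 : x ≉ 0#) → x * inv x≉0 ≈ 1#
  inv-inverseʳ {x} x≉0 = proj₂ (proj₂ (invertible x x≉0))

  *-cancelˡ : ∀ {x y z} → x ≉ 0# → x * y ≈ x * z → y ≈ z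
  *-cancelˡ {x} {y} {z} x≉0 xy≈xz = begin
    y                      ≈⟨ unit y ⟩
    inv x≉0 * (x * y)      ≈⟨ *-congˡ xy≈xz ⟩
    inv x≉0 * (x * z)      ≈⟨ unit z ⟨
    z                      ∎
    where
    unit : ∀ w → w ≈ inv x≉0 * (x * w)
    unit w = begin
      w                    ≈⟨ *-identityˡ w ⟨
      1# * w               ≈⟨ *-congʳ (inv-inverseˡ x≉0) ⟨
      inv x≉0 * x * w      ≈⟨ *-assoc _ _ _ ⟩
      inv x≉0 * (x * w)    ∎

  integral : ∀ {x y} → x * y ≈ 0# → x ≉ 0# → y ≈ 0#
  integral xy≈0 x≉0 = *-cancelˡ x≉0 (trans xy≈0 (sym (zeroʳ _)))

  *-nonzero : ∀ {x y} → x ≉ 0# → y ≉ 0# → x * y ≉ 0#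
  *-nonzero x≉0 y≉0 xy≈0 = y≉0 (integral xy≈0 x≉0)

  ^-nonzero : ∀ {x} n → x ≉ 0# → x ^ n ≉ 0#
  ^-nonzero zero    x≉0 = 1≉0
  ^-nonzero (suc n) x≉0 = *-nonzero x≉0 (^-nonzero n x≉0)

  ^-≈0 : ∀ {x} n → x ^ n ≈ 0# → x ≈ 0#
  ^-≈0 {x} n xⁿ≈0 with x ≈? 0#
  ... | yes x≈0 = x≈0
  ... | no  x≉0 = contradiction xⁿ≈0 (^-nonzero n x≉0)

  1^ : ∀ n → 1# ^ n ≈ 1#
  1^ zero    = refl
  1^ (suc n) = trans (*-identityˡ _) (1^ n)

  0^ : ∀ n → .{{ℕ.NonZero n}} → 0# ^ n ≈ 0#
  0^ (suc n) = zeroˡ _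

  ^-comm : ∀ x m n → (x ^ m) ^ n ≈ (x ^ n) ^ m
  ^-comm x m n = begin
    (x ^ m) ^ n   ≈⟨ ^-assocʳ x m n ⟩
    x ^ (m ℕ.* n) ≈⟨ ^-congʳ x (ℕ.*-comm m n) ⟩
    x ^ (n ℕ.* m) ≈⟨ ^-assocʳ x n m ⟨
    (x ^ n) ^ m   ∎

  private
    to : Carrier → Fin card
    to = Inverse.to enumerate
    from : Fin card → Carrier
    from = Inverse.from enumerate
    from-to : ∀ x → from (to x) ≈ x
    from-to x = Inverse.inverseʳ enumerate ≡.refl
    to-from : ∀ i → to (from i) ≡ i
    to-from i = Inverse.inverseˡ enumerate refl

  module _ (M : CommutativeMonoid c ℓ) where
    private module M = CommutativeMonoid M
    private module S = CMSum M

    -- Conjugating `g` by `enumerate` gives a permutation of `Fin card`. The commutative monoid is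
    -- arbitrary because the additive case gives the characteristic and the multiplicative case
    -- gives Fermat's little theorem.
    sum-bijection : (f : Carrier → M.Carrier) → (∀ {x y} → x ≈ y → f x M.≈ f y) →
      (g h : Carrier → Carrier) →
      (∀ {x y} → x ≈ y → g x ≈ g y) → (∀ {x y} → x ≈ y → h x ≈ h y) →
      (∀ x → g (h x) ≈ x) → (∀ x → h (g x) ≈ x) →
      S.sum (f ∘ from) M.≈ S.sum (f ∘ g ∘ from)
    sum-bijection f f-cong g h g-cong h-cong gh hg =
      M.trans (S.sum-permute (f ∘ from) π) (S.sum-cong-≋ {card} (λ i → f-cong (from-to (g (from i)))))
      where
      conj : (Carrier → Carrier) → Fin card → Fin card
      conj k = to ∘ k ∘ from
      conj-inverse : (k l : Carrier → Carrier) → (∀ {x y} → x ≈ y → k x ≈ k y) →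
        (∀ x → k (l x) ≈ x) → ∀ i → conj k (conj l i) ≡ i
      conj-inverse k l k-cong kl i =
        ≡.trans (Inverse.to-cong enumerate (trans (k-cong (from-to _)) (kl _))) (to-from i)
      π : Permutation card card
      π = permutation (conj g) (conj h) (conj-inverse g h g-cong gh) (conj-inverse h g h-cong hg)

  open MonoidMult +-monoid using () renaming (_×_ to _·_)

  -- Translation by 1 permutes the field, so adding `card` copies of 1 to the sum of all elements
  -- does not change it.
  card·1≈0 : card · 1# ≈ 0#
  card·1≈0 = +-cancelʳ Σ _ _ (begin
    card · 1# + Σ                       ≈⟨ +-congʳ (S.sum-replicate card) ⟨
    S.sum {card} (λ _ → 1#) + Σ         ≈⟨ S.∑-distrib-+ (λ _ → 1#) from ⟨
    S.sum (λ i → 1# + from i)           ≈⟨ sum-bijection +-commutativeMonoid id id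
                                             (1# +_) (- 1# +_) +-congˡ +-congˡ
                                             (λ x → cancel x (-‿inverseʳ 1#))
                                             (λ x → cancel x (-‿inverseˡ 1#)) ⟨
    Σ                                   ≈⟨ +-identityˡ Σ ⟨
    0# + Σ                              ∎)
    where
    module S = CMSum +-commutativeMonoid
    open RingProps ring using (+-cancelʳ)
    Σ = S.sum from
    cancel : ∀ {a b} x → a + b ≈ 0# → a + (b + x) ≈ x
    cancel x a+b≈0 = trans (sym (+-assoc _ _ _)) (trans (+-congʳ a+b≈0) (+-identityˡ x))

  ·1-^ : ∀ m n → (m ℕ.^ n) · 1# ≈ (m · 1#) ^ n
  ·1-^ m zero    = +-identityʳ 1#
  ·1-^ m (suc n) = trans (Mult.×1-homo-* semiring m (m ℕ.^ n)) (*-congˡ (·1-^ m n))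

  -- Here `card · 1#` is both zero and the m-th power of 1 + 1, and a field has no nonzero
  -- nilpotents.
  char2 : ∀ m → card ≡ 2 ℕ.^ m → 1# + 1# ≈ 0#
  char2 m ≡.refl =
    trans (+-congˡ (sym (+-identityʳ 1#))) (^-≈0 m (trans (sym (·1-^ 2 m)) card·1≈0))

-- The product of the nonzero elements is unchanged when all of them are
-- multiplied by a; the zero element is kept in the product as a factor 1.
fermat-suc : ∀ {n} (K : FiniteField c ℓ (suc n)) → let open FiniteField K in
  ∀ {a} → a ≉ 0# → a ^ n ≈ 1#
fermat-suc {n = n} K {a} a≉0 = *-cancelˡ Πf≉0 (begin
  Πf * a ^ n              ≈⟨ *-comm _ _ ⟩
  a ^ n * Πf              ≈⟨ *-congʳ Πh≈aⁿ ⟨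
  S.sum (h ∘ from) * Πf   ≈⟨ S.∑-distrib-+ (h ∘ from) (f ∘ from) ⟨
  S.sum (λ i → h (from i) * f (from i)) ≈⟨ S.sum-cong-≋ (λ i → step (from i)) ⟨
  S.sum (λ i → f (a * from i)) ≈⟨ sum-bijection *-commutativeMonoid f f-cong (a *_) (inv a≉0 *_) *-congˡ *-congˡ
                               (λ x → cancel x (inv-inverseʳ a≉0)) (λ x → cancel x (inv-inverseˡ a≉0)) ⟨
  Πf                      ≈⟨ *-identityʳ Πf ⟨
  Πf * 1#                 ∎)
  where
  open FiniteField K hiding (zero)
  open FieldProperties K
  open SetoidReasoning setoid
  module S = CMSum *-commutativeMonoid
  from = Inverse.from enumerate
  pick : Carrier → Carrier → Carrier
  pick u x = if does (x ≈? 0#) then 1# else u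
  pick-≈0 : ∀ {u x} → x ≈ 0# → pick u x ≈ 1#
  pick-≈0 {u} {x} x≈0 = reflexive (≡.cong (λ b → if b then 1# else u) (dec-true (x ≈? 0#) x≈0))
  pick-≉0 : ∀ {u x} → x ≉ 0# → pick u x ≈ u
  pick-≉0 {u} {x} x≉0 = reflexive (≡.cong (λ b → if b then 1# else u) (dec-false (x ≈? 0#) x≉0))
  f h : Carrier → Carrier
  f x = pick x x
  h x = pick a x
  Πf = S.sum (f ∘ from)
  cancel : ∀ {x y} z → x * y ≈ 1# → x * (y * z) ≈ z
  cancel z xy≈1 = trans (sym (*-assoc _ _ _)) (trans (*-congʳ xy≈1) (*-identityˡ z))
  f-cong : ∀ {x y} → x ≈ y → f x ≈ f y
  f-cong {x} {y} x≈y with x ≈? 0#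
  ... | yes x≈0 = trans (pick-≈0 x≈0) (sym (pick-≈0 (trans (sym x≈y) x≈0)))
  ... | no  x≉0 = trans (pick-≉0 x≉0)
                    (trans x≈y (sym (pick-≉0 (λ y≈0 → x≉0 (trans x≈y y≈0)))))
  f≉0 : ∀ x → f x ≉ 0#
  f≉0 x fx≈0 with x ≈? 0#
  ... | yes x≈0 = 1≉0 (trans (sym (pick-≈0 x≈0)) fx≈0)
  ... | no  x≉0 = x≉0 (trans (sym (pick-≉0 x≉0)) fx≈0)
  step : ∀ x → f (a * x) ≈ h x * f x
  step x with x ≈? 0#
  ... | yes x≈0 = begin
    f (a * x)  ≈⟨ pick-≈0 (trans (*-congˡ x≈0) (zeroʳ a)) ⟩
    1#         ≈⟨ *-identityˡ 1# ⟨
    1# * 1#    ≈⟨ *-cong (pick-≈0 x≈0) (pick-≈0 x≈0) ⟨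
    h x * f x  ∎
  ... | no  x≉0 = begin
    f (a * x)  ≈⟨ pick-≉0 (*-nonzero a≉0 x≉0) ⟩
    a * x      ≈⟨ *-cong (pick-≉0 x≉0) (pick-≉0 x≉0) ⟨
    h x * f x  ∎
  Π-nonzero : ∀ {m} (t : Vector Carrier m) → (∀ i → t i ≉ 0#) → S.sum t ≉ 0#
  Π-nonzero {zero}  t t≉0 = 1≉0
  Π-nonzero {suc m} t t≉0 = *-nonzero (t≉0 zero) (Π-nonzero (t ∘ suc) (t≉0 ∘ suc))
  Πf≉0 : Πf ≉ 0#
  Πf≉0 = Π-nonzero (f ∘ from) (λ i → f≉0 (from i))
  i₀ = Inverse.to enumerate 0#
  from-i₀ : from i₀ ≈ 0#
  from-i₀ = Inverse.inverseʳ enumerate ≡.refl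
  from-punchIn : ∀ j → from (punchIn i₀ j) ≉ 0#
  from-punchIn j ≈0 = Fin.punchInᵢ≢i i₀ j
    (≡.trans (≡.sym (Inverse.inverseˡ enumerate refl)) (Inverse.to-cong enumerate ≈0))
  Πh≈aⁿ : S.sum (h ∘ from) ≈ a ^ n
  Πh≈aⁿ = begin
    S.sum (h ∘ from)                                    ≈⟨ S.sum-remove {i = i₀} (h ∘ from) ⟩
    h (from i₀) * S.sum (removeAt (h ∘ from) i₀)        ≈⟨ *-cong (pick-≈0 from-i₀) (S.sum-cong-≋ (λ j → pick-≉0 (from-punchIn j))) ⟩
    1# * S.sum (replicate n a)                          ≈⟨ *-identityˡ _ ⟩
    S.sum (replicate n a)                               ≈⟨ S.sum-replicate n ⟩
    a ^ n                                               ∎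

fermat : ∀ {card} (K : FiniteField c ℓ card) → let open FiniteField K in
  ∀ x → x ^ card ≈ x
fermat {card = zero}  K x with Inverse.to (FiniteField.enumerate K) x
... | ()
fermat {card = suc n} K x with FiniteField._≈?_ K x (FiniteField.0# K)
... | yes x≈0 = trans (*-congʳ x≈0) (trans (zeroˡ _) (sym x≈0))
  where open FiniteField K
... | no  x≉0 = trans (*-congˡ (fermat-suc K x≉0)) (*-identityʳ x)
  where open FiniteField K

-- Characteristic two and the Frobenius map.

HasChar2 : ∀ {card} → FiniteField c ℓ card → Set ℓ
HasChar2 K = 1# + 1# ≈ 0#
  where open FiniteField K

module Char2 {card : ℕ} (K : FiniteField c ℓ card) (1+1≈0 : HasChar2 K) where
  open FiniteField K
  open FieldProperties K
  open SetoidReasoning setoid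

  x+x≈0 : ∀ x → x + x ≈ 0#
  x+x≈0 x = begin
    x + x            ≈⟨ +-cong (*-identityˡ x) (*-identityˡ x) ⟨
    1# * x + 1# * x  ≈⟨ distribʳ x 1# 1# ⟨
    (1# + 1#) * x    ≈⟨ *-congʳ 1+1≈0 ⟩
    0# * x           ≈⟨ zeroˡ x ⟩
    0#               ∎

  -x≈x : ∀ x → - x ≈ x
  -x≈x x = sym (+-inverseˡ-unique x x (x+x≈0 x))
    where open RingProps ring using (+-inverseˡ-unique)

  x+y≈0⇒x≈y : ∀ {x y} → x + y ≈ 0# → x ≈ y
  x+y≈0⇒x≈y {x} {y} x+y≈0 = trans (+-inverseˡ-unique x y x+y≈0) (-x≈x y)
    where open RingProps ring using (+-inverseˡ-unique)

  private
    -- Coefficients for the ring solver. Their interpretation in `K` is a homomorphism because 1 + 1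
    -- = 0, so the solver also proves identities that hold only in characteristic two.
    𝔽₂ : RawRing _ _
    𝔽₂ = record { Carrier = Bool ; _≈_ = _≡_ ; _+_ = _xor_ ; _*_ = _∧_ ; -_ = id ; 0# = false ; 1# = true }

    ⟦_⟧ : Bool → Carrier
    ⟦ false ⟧ = 0#
    ⟦ true  ⟧ = 1#

    morphism : 𝔽₂ ACR.-Raw-AlmostCommutative⟶ ACR.fromCommutativeRing commutativeRing
    morphism = record
      { ⟦_⟧    = ⟦_⟧
      ; +-homo = λ { false _ → sym (+-identityˡ _) ; true false → sym (+-identityʳ _) ; true true → sym 1+1≈0 }
      ; *-homo = λ { false _ → sym (zeroˡ _) ; true _ → sym (*-identityˡ _) }
      ; -‿homo = λ b → sym (-x≈x ⟦ b ⟧)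
      ; 0-homo = refl
      ; 1-homo = refl
      }

    _≟_ : ∀ a b → Maybe (⟦ a ⟧ ≈ ⟦ b ⟧)
    false ≟ false = just refl
    true  ≟ true  = just refl
    _     ≟ _     = nothing

  module Solver = RingSolver 𝔽₂ (ACR.fromCommutativeRing commutativeRing) morphism _≟_

  square-+ : ∀ x y → (x + y) ^ 2 ≈ x ^ 2 + y ^ 2
  square-+ = solve 2 (λ x y → (x :+ y) :^ 2 := x :^ 2 :+ y :^ 2) refl
    where open Solver

  frobenius : ∀ n x y → (x + y) ^ (2 ℕ.^ n) ≈ x ^ (2 ℕ.^ n) + y ^ (2 ℕ.^ n)
  frobenius zero    x y = solve 2 (λ x y → (x :+ y) :^ 1 := x :^ 1 :+ y :^ 1) refl x y
    where open Solver
  frobenius (suc n) x y = begin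
    (x + y) ^ (2 ℕ.* 2 ℕ.^ n)                        ≈⟨ ^-assocʳ (x + y) 2 (2 ℕ.^ n) ⟨
    ((x + y) ^ 2) ^ (2 ℕ.^ n)                        ≈⟨ ^-congˡ (2 ℕ.^ n) (square-+ x y) ⟩
    (x ^ 2 + y ^ 2) ^ (2 ℕ.^ n)                      ≈⟨ frobenius n (x ^ 2) (y ^ 2) ⟩
    (x ^ 2) ^ (2 ℕ.^ n) + (y ^ 2) ^ (2 ℕ.^ n)        ≈⟨ +-cong (^-assocʳ x 2 (2 ℕ.^ n)) (^-assocʳ y 2 (2 ℕ.^ n)) ⟩
    x ^ (2 ℕ.* 2 ℕ.^ n) + y ^ (2 ℕ.* 2 ℕ.^ n)        ∎

-- Values and degrees of homogenized polynomials.

∸-+-interchange : ∀ {a b} m n → a ℕ.≤ m → b ℕ.≤ n →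
  (m ℕ.+ n) ℕ.∸ (a ℕ.+ b) ≡ (m ℕ.∸ a) ℕ.+ (n ℕ.∸ b)
∸-+-interchange {a} {b} m n a≤m b≤n = begin
  (m ℕ.+ n) ℕ.∸ (a ℕ.+ b)       ≡⟨ ℕ.∸-+-assoc (m ℕ.+ n) a b ⟨
  ((m ℕ.+ n) ℕ.∸ a) ℕ.∸ b       ≡⟨ ≡.cong (ℕ._∸ b) (ℕ.+-∸-comm n a≤m) ⟩
  ((m ℕ.∸ a) ℕ.+ n) ℕ.∸ b       ≡⟨ ℕ.+-∸-assoc (m ℕ.∸ a) b≤n ⟩
  (m ℕ.∸ a) ℕ.+ (n ℕ.∸ b)       ∎
  where open ≡.≡-Reasoning

sum-zipWith-+ : ∀ {n} (μ ν : Vec ℕ n) → Vec.sum (Vec.zipWith ℕ._+_ μ ν) ≡ Vec.sum μ ℕ.+ Vec.sum ν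
sum-zipWith-+ []      []      = ≡.refl
sum-zipWith-+ (m ∷ μ) (n ∷ ν) =
  ≡.trans (≡.cong (m ℕ.+ n ℕ.+_) (sum-zipWith-+ μ ν)) (interchange m n (Vec.sum μ) (Vec.sum ν))
  where open CommutativeSemigroupProps ℕ.+-commutativeSemigroup using (interchange)

sum-replicate-0 : ∀ n → Vec.sum (Vec.replicate n 0) ≡ 0
sum-replicate-0 zero    = ≡.refl
sum-replicate-0 (suc n) = sum-replicate-0 n

sum-unit : ∀ {n} (i : Fin n) → Vec.sum (Vec.updateAt (Vec.replicate n 0) i suc) ≡ 1
sum-unit {suc n} zero    = ≡.cong suc (sum-replicate-0 n)
sum-unit {suc n} (suc i) = sum-unit i

module PolynomialProperties {card : ℕ} (K : FiniteField c ℓ card) where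
  open FiniteField K hiding (zero)
  open FieldProperties K
  open Polynomials K
  open SetoidReasoning setoid
  open CommutativeSemigroupProps *-commutativeSemigroup using (interchange)

  evalMonomial-+ : ∀ {n} (μ ν : Monomial n) x →
    evalMonomial (Vec.zipWith ℕ._+_ μ ν) x ≈ evalMonomial μ x * evalMonomial ν x
  evalMonomial-+ []      []      x = sym (*-identityˡ 1#)
  evalMonomial-+ (m ∷ μ) (n ∷ ν) x =
    trans (*-cong (^-homo-* (head x) m n) (evalMonomial-+ μ ν (tail x))) (interchange _ _ _ _)

  evalMonomial-1 : ∀ n (x : Vector Carrier n) → evalMonomial (Vec.replicate n 0) x ≈ 1#
  evalMonomial-1 zero    x = refl
  evalMonomial-1 (suc n) x = trans (*-identityˡ _) (evalMonomial-1 n (tail x))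

  evalMonomial-unit : ∀ {n} (i : Fin n) x →
    evalMonomial (Vec.updateAt (Vec.replicate n 0) i suc) x ≈ x i
  evalMonomial-unit {suc n} zero    x =
    trans (*-cong (*-identityʳ _) (evalMonomial-1 n (tail x))) (*-identityʳ _)
  evalMonomial-unit {suc n} (suc i) x = trans (*-identityˡ _) (evalMonomial-unit i (tail x))

  -- Homogenization in a prescribed degree, so that homogenize p is
  -- definitionally homogenizeAt (degree p) p.
  homogenizeAt : ∀ {n} → ℕ → Poly n → Poly (suc n)
  homogenizeAt D = List.map (λ (a , μ) → a , (D ℕ.∸ Vec.sum μ) ∷ μ)

  -- All listed terms are bounded, including those whose coefficients cancel, in contrast to
  -- `degree`.
  Bounded : ∀ {n} → ℕ → Poly n → Set c
  Bounded D = All (λ (_ , μ) → Vec.sum μ ℕ.≤ D)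

  module _ {n : ℕ} (X : Vector Carrier (suc n)) where

    private
      x₀ = head X
      term : ℕ → Carrier × Monomial n → Carrier
      term D (a , μ) = a * (x₀ ^ (D ℕ.∸ Vec.sum μ) * evalMonomial μ (tail X))
      val : ℕ → Poly n → Carrier
      val D p = eval (homogenizeAt D p) X

    -- The bound accompanies the value because the exponents of X₀ are truncated differences, which
    -- add up under multiplication only when no truncation occurs. With this pairing the value of a
    -- composite expression is computed along its structure, without expanding it into monomials.
    HasValue : ℕ → Poly n → Carrier → Set (c ⊔ ℓ)
    HasValue D p v = Bounded D p × val D p ≈ v

    val-++ : ∀ D p s → val D (p ++ s) ≈ val D p + val D s
    val-++ D []      s = sym (+-identityˡ _)
    val-++ D (t ∷ p) s = trans (+-congˡ (val-++ D p s)) (sym (+-assoc _ _ _))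

    term-* : ∀ {D E} s t → Vec.sum (proj₂ s) ℕ.≤ D → Vec.sum (proj₂ t) ℕ.≤ E →
      term (D ℕ.+ E) (mulTerm s t) ≈ term D s * term E t
    term-* {D} {E} (a , μ) (b , ν) μ≤D ν≤E = begin
      a * b * (x₀ ^ ((D ℕ.+ E) ℕ.∸ Vec.sum (Vec.zipWith ℕ._+_ μ ν)) * evalMonomial (Vec.zipWith ℕ._+_ μ ν) (tail X))
        ≈⟨ *-congˡ (*-cong (trans (^-congʳ x₀ exponent) (^-homo-* x₀ (D ℕ.∸ Vec.sum μ) (E ℕ.∸ Vec.sum ν)))
                           (evalMonomial-+ μ ν (tail X))) ⟩
      a * b * ((x₀ ^ (D ℕ.∸ Vec.sum μ) * x₀ ^ (E ℕ.∸ Vec.sum ν)) * (evalMonomial μ (tail X) * evalMonomial ν (tail X)))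
        ≈⟨ *-congˡ (interchange _ _ _ _) ⟩
      a * b * ((x₀ ^ (D ℕ.∸ Vec.sum μ) * evalMonomial μ (tail X)) * (x₀ ^ (E ℕ.∸ Vec.sum ν) * evalMonomial ν (tail X)))
        ≈⟨ interchange _ _ _ _ ⟩
      term D (a , μ) * term E (b , ν) ∎
      where
      exponent : (D ℕ.+ E) ℕ.∸ Vec.sum (Vec.zipWith ℕ._+_ μ ν) ≡ (D ℕ.∸ Vec.sum μ) ℕ.+ (E ℕ.∸ Vec.sum ν)
      exponent = ≡.trans (≡.cong ((D ℕ.+ E) ℕ.∸_) (sum-zipWith-+ μ ν)) (∸-+-interchange D E μ≤D ν≤E)

    HasValue-++ : ∀ {D p s v w} → HasValue D p v → HasValue D s w → HasValue D (p ++ s) (v + w)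
    HasValue-++ {D} {p} {s} (p≤D , p≈v) (s≤D , s≈w) =
      All.++⁺ p≤D s≤D , trans (val-++ D p s) (+-cong p≈v s≈w)

    HasValue-neg : ∀ {D p v} → HasValue D p v → HasValue D (List.map (λ (a , μ) → - a , μ) p) (- v)
    HasValue-neg {D} {p} (p≤D , p≈v) = All.map⁺ p≤D , trans (val-neg p) (-‿cong p≈v)
      where
      open RingProps ring using (-‿distribˡ-*; -‿+-comm; -0#≈0#)
      val-neg : ∀ p → val D (List.map (λ (a , μ) → - a , μ) p) ≈ - val D p
      val-neg []            = sym -0#≈0#
      val-neg ((a , μ) ∷ p) = trans (+-cong (sym (-‿distribˡ-* _ _)) (val-neg p)) (-‿+-comm _ _)

    HasValue-* : ∀ {D E p s v w} → HasValue D p v → HasValue E s w →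
      HasValue (D ℕ.+ E) (List.cartesianProductWith mulTerm p s) (v * w)
    HasValue-* {D} {E} {p} {s} (p≤D , p≈v) (s≤E , s≈w) =
      bounded p≤D , trans (val-* p≤D) (*-cong p≈v s≈w)
      where
      bounded-row : ∀ {t s} → Vec.sum (proj₂ t) ℕ.≤ D → Bounded E s →
        Bounded (D ℕ.+ E) (List.map (mulTerm t) s)
      bounded-row t≤D [] = []
      bounded-row {_ , μ} {(_ , ν) ∷ s} t≤D (u≤E ∷ s≤E) =
        ≡.subst (ℕ._≤ D ℕ.+ E) (≡.sym (sum-zipWith-+ μ ν)) (ℕ.+-mono-≤ t≤D u≤E) ∷ bounded-row t≤D s≤E
      bounded : ∀ {p} → Bounded D p → Bounded (D ℕ.+ E) (List.cartesianProductWith mulTerm p s)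
      bounded []          = []
      bounded (t≤D ∷ p≤D) = All.++⁺ (bounded-row t≤D s≤E) (bounded p≤D)
      val-row : ∀ {t s} → Vec.sum (proj₂ t) ℕ.≤ D → Bounded E s →
        val (D ℕ.+ E) (List.map (mulTerm t) s) ≈ term D t * val E s
      val-row t≤D [] = sym (zeroʳ _)
      val-row {t} {u ∷ s} t≤D (u≤E ∷ s≤E) =
        trans (+-cong (term-* t u t≤D u≤E) (val-row {t} t≤D s≤E)) (sym (distribˡ _ _ _))
      val-* : ∀ {p} → Bounded D p →
        val (D ℕ.+ E) (List.cartesianProductWith mulTerm p s) ≈ val D p * val E s
      val-* []          = sym (zeroˡ _)
      val-* {t ∷ p} (t≤D ∷ p≤D) = begin
        val (D ℕ.+ E) (List.map (mulTerm t) s ++ List.cartesianProductWith mulTerm p s)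
          ≈⟨ val-++ (D ℕ.+ E) (List.map (mulTerm t) s) _ ⟩
        val (D ℕ.+ E) (List.map (mulTerm t) s) + val (D ℕ.+ E) (List.cartesianProductWith mulTerm p s)
          ≈⟨ +-cong (val-row {t} t≤D s≤E) (val-* p≤D) ⟩
        term D t * val E s + val D p * val E s
          ≈⟨ distribʳ _ _ _ ⟨
        (term D t + val D p) * val E s ∎

    HasValue-con : ∀ a → HasValue 0 (con a) a
    HasValue-con a = ℕ.≤-reflexive (sum-replicate-0 n) ∷ [] , (begin
      a * (x₀ ^ (0 ℕ.∸ Vec.sum (Vec.replicate n 0)) * evalMonomial (Vec.replicate n 0) (tail X)) + 0#
        ≈⟨ +-identityʳ _ ⟩
      a * (x₀ ^ (0 ℕ.∸ Vec.sum (Vec.replicate n 0)) * evalMonomial (Vec.replicate n 0) (tail X))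
        ≈⟨ *-congˡ (*-cong (^-congʳ x₀ (ℕ.0∸n≡0 (Vec.sum (Vec.replicate n 0)))) (evalMonomial-1 n (tail X))) ⟩
      a * (1# * 1#)
        ≈⟨ trans (*-congˡ (*-identityˡ 1#)) (*-identityʳ a) ⟩
      a ∎)

    HasValue-var : ∀ i → HasValue 1 (var i) (tail X i)
    HasValue-var i = ℕ.≤-reflexive (sum-unit i) ∷ [] , (begin
      1# * (x₀ ^ (1 ℕ.∸ Vec.sum μ) * evalMonomial μ (tail X)) + 0#
        ≈⟨ trans (+-identityʳ _) (*-identityˡ _) ⟩
      x₀ ^ (1 ℕ.∸ Vec.sum μ) * evalMonomial μ (tail X)
        ≈⟨ *-cong (^-congʳ x₀ (≡.cong (1 ℕ.∸_) (sum-unit i))) (evalMonomial-unit i (tail X)) ⟩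
      1# * tail X i
        ≈⟨ *-identityˡ _ ⟩
      tail X i ∎)
      where μ = Vec.updateAt (Vec.replicate n 0) i suc

    HasValue-≡ : ∀ {D E p v} → D ≡ E → HasValue D p v → HasValue E p v
    HasValue-≡ ≡.refl p-v = p-v

    -- The exponent E - |μ| of X₀ splits as (E - D) + (D - |μ|), so all terms gain the same factor.
    -- This brings summands of different degrees to a common one.
    HasValue-raise : ∀ {D p v} E → D ℕ.≤ E → HasValue D p v → HasValue E p (x₀ ^ (E ℕ.∸ D) * v)
    HasValue-raise {D} E D≤E (p≤D , p≈v) =
      All.map (λ t≤D → ℕ.≤-trans t≤D D≤E) p≤D , trans (val-raise p≤D) (*-congˡ p≈v)
      where
      term-raise : ∀ {t} → Vec.sum (proj₂ t) ℕ.≤ D → term E t ≈ x₀ ^ (E ℕ.∸ D) * term D t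
      term-raise {a , μ} μ≤D = begin
        a * (x₀ ^ (E ℕ.∸ Vec.sum μ) * m)
          ≈⟨ *-congˡ (*-congʳ (trans (^-congʳ x₀ exponent) (^-homo-* x₀ (E ℕ.∸ D) (D ℕ.∸ Vec.sum μ)))) ⟩
        a * (x₀ ^ (E ℕ.∸ D) * x₀ ^ (D ℕ.∸ Vec.sum μ) * m)
          ≈⟨ *-congˡ (*-assoc _ _ _) ⟩
        a * (x₀ ^ (E ℕ.∸ D) * (x₀ ^ (D ℕ.∸ Vec.sum μ) * m))
          ≈⟨ x∙yz≈y∙xz _ _ _ ⟩
        x₀ ^ (E ℕ.∸ D) * term D (a , μ) ∎
        where
        m = evalMonomial μ (tail X)
        open CommutativeSemigroupProps *-commutativeSemigroup using (x∙yz≈y∙xz)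
        exponent : E ℕ.∸ Vec.sum μ ≡ (E ℕ.∸ D) ℕ.+ (D ℕ.∸ Vec.sum μ)
        exponent = ≡.trans (≡.cong (ℕ._∸ Vec.sum μ) (≡.sym (ℕ.m∸n+n≡m D≤E))) (ℕ.+-∸-assoc (E ℕ.∸ D) μ≤D)
      val-raise : ∀ {p} → Bounded D p → val E p ≈ x₀ ^ (E ℕ.∸ D) * val D p
      val-raise []          = sym (zeroʳ _)
      val-raise {t ∷ _} (t≤D ∷ p≤D) = trans (+-cong (term-raise {t} t≤D) (val-raise p≤D)) (sym (distribˡ _ _ _))

    HasValue-^ : ∀ {D p v} k → HasValue D p v →
      HasValue (k ℕ.* D) (RawSemiringDefs._^_ (RawRing.rawSemiring (polyRing n)) p k) (v ^ k)
    HasValue-^ zero    p-v = HasValue-con 1#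
    HasValue-^ (suc k) p-v = HasValue-* p-v (HasValue-^ k p-v)

  coeff-∷-≡ : ∀ {n} a {ν μ : Monomial n} p → ν ≡ μ → coeff ((a , ν) ∷ p) μ ≡ a + coeff p μ
  coeff-∷-≡ a {ν} {μ} p ν≡μ = ≡.cong (λ b → if b then a + coeff p μ else coeff p μ)
    (dec-true (Vec.≡-dec ℕ._≟_ ν μ) ν≡μ)

  coeff-∷-≢ : ∀ {n} a {ν μ : Monomial n} p → ν ≢ μ → coeff ((a , ν) ∷ p) μ ≡ coeff p μ
  coeff-∷-≢ a {ν} {μ} p ν≢μ = ≡.cong (λ b → if b then a + coeff p μ else coeff p μ)
    (dec-false (Vec.≡-dec ℕ._≟_ ν μ) ν≢μ)

  -- The value of the homogenization at (0 : 1 : 0 : … : 0) singles out the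
  -- term a x₁ᴰ.
  coeff-pure : ∀ {n} D (p : Poly (suc n)) → Bounded D p →
    coeff p (D ∷ Vec.replicate n 0) ≈ eval (homogenizeAt D p) (0# Vector.∷ (1# Vector.∷ 𝟎))
  coeff-pure {n} D [] [] = refl
  coeff-pure {n} D ((a , m ∷ ν) ∷ p) (t≤D ∷ p≤D)
    with Vec.≡-dec ℕ._≟_ (m ∷ ν) (D ∷ Vec.replicate n 0)
  ... | yes ≡.refl = trans (reflexive (coeff-∷-≡ a p ≡.refl))
    (+-cong (sym (trans (*-congˡ is-one) (*-identityʳ a))) (coeff-pure D p p≤D))
    where
    is-one : 0# ^ (D ℕ.∸ (D ℕ.+ Vec.sum (Vec.replicate n 0))) * (1# ^ D * evalMonomial (Vec.replicate n 0) 𝟎) ≈ 1#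
    is-one = trans
      (*-cong (^-congʳ 0# (ℕ.m≤n⇒m∸n≡0 (ℕ.m≤m+n D _)))
              (trans (*-cong (1^ D) (evalMonomial-1 n 𝟎)) (*-identityˡ 1#)))
      (*-identityˡ 1#)
  ... | no μ≢ = trans (reflexive (coeff-∷-≢ a p μ≢)) (trans (coeff-pure D p p≤D)
    (sym (trans (+-congʳ (trans (*-congˡ is-zero) (zeroʳ a))) (+-identityˡ _))))
    where
    evalMonomial-𝟎 : ∀ {n} (ν : Monomial n) → ν ≢ Vec.replicate n 0 → evalMonomial ν 𝟎 ≈ 0#
    evalMonomial-𝟎 []          ν≢0 = contradiction ≡.refl ν≢0
    evalMonomial-𝟎 (zero  ∷ ν) ν≢0 =
      trans (*-identityˡ _) (evalMonomial-𝟎 ν (ν≢0 ∘ ≡.cong (0 ∷_)))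
    evalMonomial-𝟎 (suc _ ∷ ν) ν≢0 = trans (*-congʳ (zeroˡ _)) (zeroˡ _)
    is-zero : 0# ^ (D ℕ.∸ (m ℕ.+ Vec.sum ν)) * (1# ^ m * evalMonomial ν 𝟎) ≈ 0#
    is-zero with Vec.≡-dec ℕ._≟_ ν (Vec.replicate n 0)
    ... | no ν≢0     = trans (*-congˡ (trans (*-congˡ (evalMonomial-𝟎 ν ν≢0)) (zeroʳ _))) (zeroʳ _)
    ... | yes ≡.refl = trans (*-congʳ (0^ (D ℕ.∸ (m ℕ.+ Vec.sum ν)) {{ℕ.>-nonZero (ℕ.m<n⇒0<n∸m t<D)}})) (zeroˡ _)
      where
      t<D : m ℕ.+ Vec.sum ν ℕ.< D
      t<D = ℕ.≤∧≢⇒< t≤D λ t≡D → μ≢ (≡.cong (_∷ ν)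
        (≡.trans (≡.sym (≡.trans (≡.cong (m ℕ.+_) (sum-replicate-0 n)) (ℕ.+-identityʳ m))) t≡D))

  private
    -- The fold inside `degree` with its zero test abstracted to `b`. In `degree` the test refers to
    -- the whole polynomial, which would obstruct induction on the list of terms.
    maxDegree : ∀ {n} → (Monomial n → Bool) → Poly n → ℕ
    maxDegree b = List.foldr (λ (_ , μ) d → if b μ then d else Vec.sum μ ℕ.⊔ d) 0

    maxDegree-≤ : ∀ {n D} b {p : Poly n} → Bounded D p → maxDegree b p ℕ.≤ D
    maxDegree-≤ b [] = ℕ.z≤n
    maxDegree-≤ b {(_ , μ) ∷ p} (t≤D ∷ p≤D) with b μ
    ... | true  = maxDegree-≤ b p≤D
    ... | false = ℕ.⊔-lub t≤D (maxDegree-≤ b p≤D)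

    ≤-maxDegree : ∀ {n μ} b {p : Poly n} → b μ ≡ false → Any (λ t → proj₂ t ≡ μ) p →
      Vec.sum μ ℕ.≤ maxDegree b p
    ≤-maxDegree b bμ (here ≡.refl) rewrite bμ = ℕ.m≤m⊔n _ _
    ≤-maxDegree b {(_ , ν) ∷ p} bμ (there μ∈p) with b ν
    ... | true  = ≤-maxDegree b bμ μ∈p
    ... | false = ℕ.≤-trans (≤-maxDegree b bμ μ∈p) (ℕ.m≤n⊔m (Vec.sum ν) _)

    occurs : ∀ {n} (p : Poly n) μ → coeff p μ ≉ 0# → Any (λ t → proj₂ t ≡ μ) p
    occurs []            μ coeff≉0 = contradiction refl coeff≉0
    occurs ((a , ν) ∷ p) μ coeff≉0 with Vec.≡-dec ℕ._≟_ ν μ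
    ... | yes ν≡μ = here ν≡μ
    ... | no  _   = there (occurs p μ coeff≉0)

  -- The upper bound comes from `Bounded`. For the lower one, the value at (0 : 1 : 0 : ... : 0) is
  -- the coefficient of x₁ᴰ, so this monomial survives all cancellation.
  degree-≡ : ∀ {n} D (p : Poly (suc n)) → Bounded D p →
    eval (homogenizeAt D p) (0# Vector.∷ (1# Vector.∷ 𝟎)) ≉ 0# → degree p ≡ D
  degree-≡ {n} D p p≤D value≉0 = ℕ.≤-antisym (maxDegree-≤ _ p≤D)
    (≡.subst (ℕ._≤ degree p) (≡.trans (≡.cong (D ℕ.+_) (sum-replicate-0 n)) (ℕ.+-identityʳ D))
      (≤-maxDegree _ (dec-false (coeff p _ ≈? 0#) coeff≉0) (occurs p _ coeff≉0)))
    where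
    coeff≉0 : coeff p (D ∷ Vec.replicate n 0) ≉ 0#
    coeff≉0 = value≉0 ∘ trans (sym (coeff-pure D p p≤D))

-- The homogenized equation of the variety.

module HomogenizedVariety {card : ℕ} (K : FiniteField c ℓ card) where
  open FiniteField K hiding (zero)
  open FieldProperties K
  open Polynomials K
  open PolynomialProperties K
  open SetoidReasoning setoid

  ΓK : ℕ → ℕ → Carrier → Carrier → Carrier
  ΓK = Γ (CommutativeRing.rawRing commutativeRing)

  -- The homogenization of Γ in degree (σ + 2) q when X₀ is idempotent, so
  -- that all positive powers of X₀ agree.
  Γʰ : ℕ → ℕ → Carrier → Carrier → Carrier → Carrier
  Γʰ q σ ε x₀ x = (x₀ * x + (x ^ q + x₀ * x) * ε) ^ (σ ℕ.+ 2) + x₀ * (x ^ q + x₀ * x) ^ σ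
                + x₀ * ((x ^ (2 ℕ.* q) + x₀ * x ^ 2) * ε) + x₀ * x ^ (q ℕ.+ 1) + x₀ * x ^ 2

  module _ {n : ℕ} (X : Vector Carrier (suc n)) (idem : head X * head X ≈ head X)
           {q σ : ℕ} (1<q : 1 ℕ.< q) (0<σ : 0 ℕ.< σ) where
    private
      x₀ = head X
      D = (σ ℕ.+ 2) ℕ.* q
      R = polyRing n
      idem^ : ∀ k → .{{ℕ.NonZero k}} → x₀ ^ k ≈ x₀
      idem^ (suc zero)    = *-identityʳ x₀
      idem^ (suc (suc k)) = trans (*-congˡ (idem^ (suc k))) idem

    -- Strictness makes the exponent E - D positive, so that idempotence turns the power of X₀ into
    -- X₀ itself; the zeroth power would be 1.
    raise : ∀ {D p v} E → D ℕ.< E → HasValue X D p v → HasValue X E p (x₀ * v)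
    raise {D} E D<E p-v with HasValue-raise X E (ℕ.<⇒≤ D<E) p-v
    ... | p≤E , p≈v = p≤E , trans p≈v (*-congʳ (idem^ (E ℕ.∸ D) {{ℕ.>-nonZero (ℕ.m<n⇒0<n∸m D<E)}}))

    2*q<D : 2 ℕ.* q ℕ.< D
    2*q<D = ℕ.*-monoˡ-< q {{ℕ.>-nonZero (ℕ.<-trans ℕ.z<s 1<q)}} (ℕ.m<n+m 2 0<σ)

    q+1<2*q : q ℕ.+ 1 ℕ.< 2 ℕ.* q
    q+1<2*q = ℕ.+-monoʳ-< q (ℕ.<-≤-trans 1<q (ℕ.m≤m+n q 0))

    -- The derivation follows the five summands of `Γ`. The first has degree (σ + 2)q = D; the other
    -- four have smaller degree, and raising each of them yields a factor X₀.
    HasValue-Γ : ∀ {p x} ε → HasValue X 1 p x → HasValue X D (Γ R q σ (con ε) p) (Γʰ q σ ε x₀ x)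
    HasValue-Γ {p} {x} ε p-x = HasValue-++ X (HasValue-++ X (HasValue-++ X (HasValue-++ X
      (HasValue-^ X (σ ℕ.+ 2) (HasValue-++ X (raise q 1<q p-x) (HasValue-≡ X (ℕ.+-identityʳ q) (HasValue-* X trace (HasValue-con X ε)))))
      (raise D (ℕ.*-monoˡ-< q {{ℕ.>-nonZero (ℕ.<-trans ℕ.z<s 1<q)}} (ℕ.m<m+n σ ℕ.z<s)) (HasValue-^ X σ trace)))
      (raise D 2*q<D (HasValue-≡ X (ℕ.+-identityʳ (2 ℕ.* q)) (HasValue-* X
        (HasValue-++ X (power (2 ℕ.* q)) (raise (2 ℕ.* q) (ℕ.*-monoʳ-< 2 1<q) (power 2)))
        (HasValue-con X ε)))))
      (raise D (ℕ.<-trans q+1<2*q 2*q<D) (power (q ℕ.+ 1))))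
      (raise D (ℕ.<-trans (ℕ.*-monoʳ-< 2 1<q) 2*q<D) (power 2))
      where
      open RawSemiringDefs (RawRing.rawSemiring R) using () renaming (_^_ to _^ᴾ_)
      power : ∀ k → HasValue X k (p ^ᴾ k) (x ^ k)
      power k = HasValue-≡ X (ℕ.*-identityʳ k) (HasValue-^ X k p-x)
      trace : HasValue X q (RawRing._+_ R (p ^ᴾ q) p) (x ^ q + x₀ * x)
      trace = HasValue-++ X (power q) (raise q 1<q p-x)

    HasValue-sum : ∀ {E k} (p : Fin k → Poly n) (v : Fin k → Carrier) →
      (∀ i → HasValue X E (p i) (v i)) →
      HasValue X E (RawSemiringDefs.sum (RawRing.rawSemiring R) p) (sum v)
    HasValue-sum {k = zero}  p v p-v = All.[] , refl
    HasValue-sum {k = suc k} p v p-v =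
      HasValue-++ X (p-v zero) (HasValue-sum (p ∘ suc) (v ∘ suc) (p-v ∘ suc))

  module _ (e : ℕ) (0<e : 0 ℕ.< e) where
    open Variety K e
    open Projective K
    private
      q = 2 ℕ.^ e
      σ = 2 ℕ.^ ((e ℕ.+ 1) / 2)
      D = (σ ℕ.+ 2) ℕ.* q
      1<q : 1 ℕ.< q
      1<q = ℕ.^-monoʳ-< 2 ℕ.≤-refl 0<e
      0<σ : 0 ℕ.< σ
      0<σ = ℕ.m^n>0 2 ((e ℕ.+ 1) / 2)

    module _ (k : ℕ) (ε : Carrier) where
      homogenizedEquation : Vector Carrier (suc (suc k)) → Carrier
      homogenizedEquation X =
        head X * (tail X (fromℕ k) ^ q + head X * tail X (fromℕ k))
        + - sum (λ (i : Fin k) → Γʰ q σ ε (head X) (tail X (inject₁ i)))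

      HasValue-affineEquation : ∀ X → head X * head X ≈ head X →
        HasValue X D (affineEquation k ε) (homogenizedEquation X)
      HasValue-affineEquation X idem = HasValue-++ X
        (raise X idem 1<q 0<σ D q<D
          (HasValue-++ X (HasValue-≡ X (ℕ.*-identityʳ q) (HasValue-^ X q (HasValue-var X (fromℕ k))))
                         (raise X idem 1<q 0<σ q 1<q (HasValue-var X (fromℕ k)))))
        (HasValue-neg X (HasValue-sum X idem 1<q 0<σ _ _
          (λ i → HasValue-Γ X idem 1<q 0<σ ε (HasValue-var X (inject₁ i)))))
        where
        q<D : q ℕ.< D
        q<D = ℕ.≤-<-trans (ℕ.m≤m+n q _) (2*q<D X idem 1<q 0<σ)

-- The residue of σ + 2 modulo 3.

4^≡1mod3 : ∀ j → ∃[ w ] 2 ℕ.^ (j ℕ.* 2) ≡ 1 ℕ.+ w ℕ.* 3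
4^≡1mod3 zero = 0 , ≡.refl
4^≡1mod3 (suc j) with 4^≡1mod3 j
... | w , eq = 1 ℕ.+ 4 ℕ.* w , ≡.trans (≡.cong (λ m → 2 ℕ.* (2 ℕ.* m)) eq)
  (solve 1 (λ w → con 2 :* (con 2 :* (con 1 :+ w :* con 3)) := con 1 :+ (con 1 :+ con 4 :* w) :* con 3) ≡.refl w)
  where open +-*-Solver

half : ∀ {e} k → e ≡ 1 ℕ.+ k ℕ.* 2 → (e ℕ.+ 1) / 2 ≡ suc k
half k ≡.refl = ≡.trans (≡.cong (_/ 2) (ℕ.+-comm (1 ℕ.+ k ℕ.* 2) 1)) (m*n/n≡m (suc k) 2)

odd-form : ∀ e → e % 2 ≡ 1 → e ≡ 1 ℕ.+ e / 2 ℕ.* 2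
odd-form e e-odd = ≡.trans (m≡m%n+[m/n]*n e 2) (≡.cong (ℕ._+ e / 2 ℕ.* 2) e-odd)

-- For e = 4m + 1 the exponent (e + 1)/2 is 2m + 1, hence σ = 2·4^m is 2 modulo 3.
σ+2-mod-3-of-1 : ∀ e → e % 4 ≡ 1 → ∃[ w ] 2 ℕ.^ ((e ℕ.+ 1) / 2) ℕ.+ 2 ≡ 1 ℕ.+ 3 ℕ.* w
σ+2-mod-3-of-1 e e≡1 with 4^≡1mod3 (e / 4)
... | w , eq = 1 ℕ.+ 2 ℕ.* w , ≡.trans
  (≡.cong (λ m → 2 ℕ.^ m ℕ.+ 2) (half (e / 4 ℕ.* 2)
    (≡.trans (m≡m%n+[m/n]*n e 4) (≡.cong₂ ℕ._+_ e≡1 (≡.sym (ℕ.*-assoc (e / 4) 2 2))))))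
  (≡.trans (≡.cong (λ m → 2 ℕ.* m ℕ.+ 2) eq)
    (solve 1 (λ w → con 2 :* (con 1 :+ w :* con 3) :+ con 2 := con 1 :+ con 3 :* (con 1 :+ con 2 :* w)) ≡.refl w))
  where open +-*-Solver

-- For e = 4m + 3 the exponent (e + 1)/2 is 2(m + 1), hence σ = 4^(m+1) is 1 modulo 3.
σ+2-mod-3-of-3 : ∀ e → e % 4 ≡ 3 → ∃[ w ] 2 ℕ.^ ((e ℕ.+ 1) / 2) ℕ.+ 2 ≡ 3 ℕ.* w
σ+2-mod-3-of-3 e e≡3 with 4^≡1mod3 (suc (e / 4))
... | w , eq = 1 ℕ.+ w , ≡.trans
  (≡.cong (λ m → 2 ℕ.^ m ℕ.+ 2) (half (1 ℕ.+ e / 4 ℕ.* 2)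
    (≡.trans (m≡m%n+[m/n]*n e 4) (≡.cong₂ ℕ._+_ e≡3 (≡.sym (ℕ.*-assoc (e / 4) 2 2))))))
  (≡.trans (≡.cong (ℕ._+ 2) eq)
    (solve 1 (λ w → con 1 :+ w :* con 3 :+ con 2 := con 3 :* (con 1 :+ w)) ≡.refl w))
  where open +-*-Solver

odd-mod-4 : ∀ e → e % 2 ≡ 1 → e % 4 ≡ 1 ⊎ e % 4 ≡ 3
odd-mod-4 e e-odd = split (e % 4) ≡.refl (m%n<n e 4)
  where
  even-absurd : ∀ m → e % 4 ≡ m → m % 2 ≡ 0 → ¬ (e % 2 ≡ 1)
  even-absurd m eq m-even e%2≡1 = contradiction (≡.trans (≡.sym e%2≡1) (≡.trans (≡.cong (_% 2)
    (≡.trans (m≡m%n+[m/n]*n e 4) (≡.cong₂ ℕ._+_ eq (≡.sym (ℕ.*-assoc (e / 4) 2 2)))))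
    (≡.trans ([m+kn]%n≡m%n m (e / 4 ℕ.* 2) 2) m-even))) λ ()
  split : ∀ m → e % 4 ≡ m → m ℕ.< 4 → e % 4 ≡ 1 ⊎ e % 4 ≡ 3
  split 0 eq _ = contradiction e-odd (even-absurd 0 eq ≡.refl)
  split 1 eq _ = inj₁ eq
  split 2 eq _ = contradiction e-odd (even-absurd 2 eq ≡.refl)
  split 3 eq _ = inj₂ eq
  split (suc (suc (suc (suc _)))) _ (ℕ.s≤s (ℕ.s≤s (ℕ.s≤s (ℕ.s≤s ()))))

-- The field of order q² over its subfield of order q, and roots of unity of order dividing σ + 2.

module QuadraticExtension (e : ℕ) (e-odd : e % 2 ≡ 1)
  (K : FiniteField c ℓ ((2 ℕ.^ e) ℕ.^ 2)) where
  open FiniteField K hiding (zero)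
  open FieldProperties K public
  open HomogenizedVariety K public using (ΓK)
  open SetoidReasoning setoid

  -- Since e is odd and e / 2 is rounded down, τσ = q and σ = 2τ. Thus raising to the power `τ`
  -- inverts raising to the power `σ` on the subfield, and σ² = 2q.
  q σ τ : ℕ
  q = 2 ℕ.^ e
  σ = 2 ℕ.^ ((e ℕ.+ 1) / 2)
  τ = 2 ℕ.^ (e / 2)

  σ≡2τ : σ ≡ 2 ℕ.* τ
  σ≡2τ = ≡.cong (2 ℕ.^_) (half (e / 2) (odd-form e e-odd))

  τσ≡q : τ ℕ.* σ ≡ q
  τσ≡q = ≡.trans (≡.sym (ℕ.^-distribˡ-+-* 2 (e / 2) ((e ℕ.+ 1) / 2)))
    (≡.cong (2 ℕ.^_) (≡.trans (≡.cong (e / 2 ℕ.+_) (half (e / 2) (odd-form e e-odd)))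
      (≡.trans (solve 1 (λ k → k :+ (con 1 :+ k) := con 1 :+ k :* con 2) ≡.refl (e / 2))
        (≡.sym (odd-form e e-odd)))))
    where open +-*-Solver

  1+1≈0 : 1# + 1# ≈ 0#
  1+1≈0 = char2 (e ℕ.* 2) (ℕ.^-*-assoc 2 e 2)

  open Char2 K 1+1≈0 public

  ^q-+ : ∀ x y → (x + y) ^ q ≈ x ^ q + y ^ q
  ^q-+ = frobenius e

  ^q-* : ∀ x y → (x * y) ^ q ≈ x ^ q * y ^ q
  ^q-* x y = ^-distrib-* x y q

  ^q-involutive : ∀ x → (x ^ q) ^ q ≈ x
  ^q-involutive x = begin
    (x ^ q) ^ q     ≈⟨ ^-assocʳ x q q ⟩
    x ^ (q ℕ.* q)   ≈⟨ ^-congʳ x (≡.cong (q ℕ.*_) (ℕ.*-identityʳ q)) ⟨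
    x ^ (q ℕ.^ 2)   ≈⟨ fermat K x ⟩
    x               ∎

  ^q-injective : ∀ {x y} → x ^ q ≈ y ^ q → x ≈ y
  ^q-injective {x} {y} eq = trans (sym (^q-involutive x)) (trans (^-congˡ q eq) (^q-involutive y))

  sub-+ : ∀ {x y} → InSubfield q x → InSubfield q y → InSubfield q (x + y)
  sub-+ x∈ y∈ = trans (^q-+ _ _) (+-cong x∈ y∈)

  sub-* : ∀ {x y} → InSubfield q x → InSubfield q y → InSubfield q (x * y)
  sub-* x∈ y∈ = trans (^q-* _ _) (*-cong x∈ y∈)

  sub-^ : ∀ {x} n → InSubfield q x → InSubfield q (x ^ n)
  sub-^ {x} n x∈ = trans (^-comm x n q) (^-congˡ n x∈)

  sub-cong : ∀ {x y} → x ≈ y → InSubfield q x → InSubfield q y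
  sub-cong x≈y x∈ = trans (^-congˡ q (sym x≈y)) (trans x∈ x≈y)

  sub-trace : ∀ x → InSubfield q (x ^ q + x)
  sub-trace x = trans (^q-+ _ _) (trans (+-congʳ (^q-involutive x)) (+-comm _ _))

  square≈1 : ∀ {x} → x ^ 2 ≈ 1# → x ≈ 1#
  square≈1 {x} x²≈1 = x+y≈0⇒x≈y (^-≈0 2 (begin
    (x + 1#) ^ 2    ≈⟨ square-+ x 1# ⟩
    x ^ 2 + 1# ^ 2  ≈⟨ +-cong x²≈1 (1^ 2) ⟩
    1# + 1#         ≈⟨ 1+1≈0 ⟩
    0#              ∎))

  -- Raising the hypothesis to the power σ gives y^(2σ) y^(2q) = 1, because σ² = 2q, and squaring it
  -- gives y^(2σ) y⁴ = 1; hence y^(2q) = y⁴. Using this twice, y⁸ = y^(4q) = (y^(2q))^q = y², so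
  -- (y³)² = 1, and squaring is injective.
  cube-of-unity : ∀ {y} → y ^ (σ ℕ.+ 2) ≈ 1# → y ^ 3 ≈ 1#
  cube-of-unity {y} yᴺ≈1 = square≈1 (*-cancelˡ (^-nonzero 2 y≉0) (begin
    y ^ 2 * (y ^ 3) ^ 2       ≈⟨ solve 1 (λ y → y :^ 2 :* (y :^ 3) :^ 2 := (y :^ 4) :^ 2) refl y ⟩
    (y ^ 4) ^ 2               ≈⟨ ^-congˡ 2 y^2q≈y⁴ ⟨
    (y ^ (2 ℕ.* q)) ^ 2       ≈⟨ trans (^-comm y (2 ℕ.* q) 2) (sym (^-assocʳ (y ^ 2) 2 q)) ⟩
    ((y ^ 2) ^ 2) ^ q         ≈⟨ ^-congˡ q (^-assocʳ y 2 2) ⟩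
    (y ^ 4) ^ q               ≈⟨ ^-congˡ q y^2q≈y⁴ ⟨
    (y ^ (2 ℕ.* q)) ^ q       ≈⟨ ^-congˡ q (^-assocʳ y 2 q) ⟨
    ((y ^ 2) ^ q) ^ q         ≈⟨ ^q-involutive (y ^ 2) ⟩
    y ^ 2                     ≈⟨ *-identityʳ _ ⟨
    y ^ 2 * 1#                ∎))
    where
    open Solver
    y≉0 : y ≉ 0#
    y≉0 y≈0 = 1≉0 (trans (sym yᴺ≈1) (trans (^-congˡ (σ ℕ.+ 2) y≈0)
      (0^ (σ ℕ.+ 2) {{ℕ.>-nonZero (ℕ.<-≤-trans ℕ.z<s (ℕ.m≤n+m 2 σ))}})))
    power≈1 : ∀ m → y ^ ((σ ℕ.+ 2) ℕ.* m) ≈ 1#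
    power≈1 m = trans (sym (^-assocʳ y (σ ℕ.+ 2) m)) (trans (^-congˡ m yᴺ≈1) (1^ m))
    exponent : (σ ℕ.+ 2) ℕ.* σ ≡ 2 ℕ.* σ ℕ.+ 2 ℕ.* q
    exponent = ≡.trans (ℕ.*-distribʳ-+ σ σ 2) (≡.trans (ℕ.+-comm (σ ℕ.* σ) (2 ℕ.* σ))
      (≡.cong (2 ℕ.* σ ℕ.+_) (≡.trans (≡.cong (ℕ._* σ) σ≡2τ)
        (≡.trans (ℕ.*-assoc 2 τ σ) (≡.cong (2 ℕ.*_) τσ≡q)))))
    y^2q≈y⁴ : y ^ (2 ℕ.* q) ≈ y ^ 4
    y^2q≈y⁴ = *-cancelˡ (^-nonzero (2 ℕ.* σ) y≉0) (begin
      y ^ (2 ℕ.* σ) * y ^ (2 ℕ.* q)  ≈⟨ ^-homo-* y (2 ℕ.* σ) (2 ℕ.* q) ⟨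
      y ^ (2 ℕ.* σ ℕ.+ 2 ℕ.* q)      ≈⟨ ^-congʳ y exponent ⟨
      y ^ ((σ ℕ.+ 2) ℕ.* σ)          ≈⟨ power≈1 σ ⟩
      1#                             ≈⟨ power≈1 2 ⟨
      y ^ ((σ ℕ.+ 2) ℕ.* 2)          ≈⟨ ^-congʳ y (≡.trans (ℕ.*-comm (σ ℕ.+ 2) 2) (ℕ.*-distribˡ-+ 2 σ 2)) ⟩
      y ^ (2 ℕ.* σ ℕ.+ 4)            ≈⟨ ^-homo-* y (2 ℕ.* σ) 4 ⟩
      y ^ (2 ℕ.* σ) * y ^ 4          ∎)

  -- As y³ = 1 and σ + 2 = 1 + 3w, the power y^(σ+2) collapses to y.
  unity-of-1-mod-4 : e % 4 ≡ 1 → ∀ {y} → y ^ (σ ℕ.+ 2) ≈ 1# → y ≈ 1#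
  unity-of-1-mod-4 e≡1 {y} yᴺ≈1 with σ+2-mod-3-of-1 e e≡1
  ... | w , σ+2≡ = begin
    y                  ≈⟨ *-identityʳ y ⟨
    y * 1#             ≈⟨ *-congˡ (trans (^-congˡ w (cube-of-unity yᴺ≈1)) (1^ w)) ⟨
    y * (y ^ 3) ^ w    ≈⟨ *-congˡ (^-assocʳ y 3 w) ⟩
    y ^ (1 ℕ.+ 3 ℕ.* w) ≈⟨ ^-congʳ y σ+2≡ ⟨
    y ^ (σ ℕ.+ 2)      ≈⟨ yᴺ≈1 ⟩
    1#                 ∎

  ^σ+2-injective : e % 4 ≡ 1 → ∀ {x y} → x ^ (σ ℕ.+ 2) ≈ y ^ (σ ℕ.+ 2) → x ≈ y
  ^σ+2-injective e≡1 {x} {y} eq with y ≈? 0#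
  ... | yes y≈0 = trans (^-≈0 (σ ℕ.+ 2) (trans eq (trans (^-congˡ (σ ℕ.+ 2) y≈0)
      (0^ (σ ℕ.+ 2) {{ℕ.>-nonZero (ℕ.<-≤-trans ℕ.z<s (ℕ.m≤n+m 2 σ))}})))) (sym y≈0)
  ... | no  y≉0 = *-cancelˡ (inv≉0) (trans (unity-of-1-mod-4 e≡1 (begin
    (inv y≉0 * x) ^ (σ ℕ.+ 2)            ≈⟨ ^-distrib-* _ _ (σ ℕ.+ 2) ⟩
    inv y≉0 ^ (σ ℕ.+ 2) * x ^ (σ ℕ.+ 2)  ≈⟨ *-congˡ eq ⟩
    inv y≉0 ^ (σ ℕ.+ 2) * y ^ (σ ℕ.+ 2)  ≈⟨ ^-distrib-* _ _ (σ ℕ.+ 2) ⟨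
    (inv y≉0 * y) ^ (σ ℕ.+ 2)            ≈⟨ ^-congˡ (σ ℕ.+ 2) (inv-inverseˡ y≉0) ⟩
    1# ^ (σ ℕ.+ 2)                       ≈⟨ 1^ (σ ℕ.+ 2) ⟩
    1#                                   ∎)) (sym (inv-inverseˡ y≉0)))
    where
    inv≉0 : inv y≉0 ≉ 0#
    inv≉0 inv≈0 = 1≉0 (trans (sym (inv-inverseˡ y≉0)) (trans (*-congʳ inv≈0) (zeroˡ y)))

  -- The absolute trace and the Artin-Schreier equation.

  absTrace-suc : ∀ n x → absTrace (suc n) x ≈ x + absTrace n (x ^ 2)
  absTrace-suc n x = +-cong (*-identityʳ x)
    (S.sum-cong-≋ {n} λ i → sym (^-assocʳ x 2 (2 ℕ.^ toℕ i)))
    where import Algebra.Properties.CommutativeMonoid.Sum +-commutativeMonoid as S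

  absTrace-square : ∀ n x → absTrace n (x ^ 2) ≈ absTrace n x ^ 2
  absTrace-square zero    x = sym (0^ 2)
  absTrace-square (suc n) x = begin
    absTrace (suc n) (x ^ 2)           ≈⟨ absTrace-suc n (x ^ 2) ⟩
    x ^ 2 + absTrace n ((x ^ 2) ^ 2)   ≈⟨ +-congˡ (absTrace-square n (x ^ 2)) ⟩
    x ^ 2 + absTrace n (x ^ 2) ^ 2     ≈⟨ square-+ _ _ ⟨
    (x + absTrace n (x ^ 2)) ^ 2       ≈⟨ ^-congˡ 2 (absTrace-suc n x) ⟨
    absTrace (suc n) x ^ 2             ∎

  -- The sum of x^(4^i) over i < n. Its square consists of the powers x^(2·4^i) that it omits, so h²
  -- + h runs through the first 2n conjugates of x.
  halfTrace : ℕ → Carrier → Carrier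
  halfTrace zero    x = 0#
  halfTrace (suc n) x = x + halfTrace n ((x ^ 2) ^ 2)

  halfTrace-artinSchreier : ∀ n x → halfTrace n x ^ 2 + halfTrace n x ≈ absTrace (n ℕ.* 2) x
  halfTrace-artinSchreier zero    x = trans (+-identityʳ _) (0^ 2)
  halfTrace-artinSchreier (suc n) x = begin
    (x + h) ^ 2 + (x + h)
      ≈⟨ solve 2 (λ x h → (x :+ h) :^ 2 :+ (x :+ h) := x :+ (x :^ 2 :+ (h :^ 2 :+ h))) refl x h ⟩
    x + (x ^ 2 + (h ^ 2 + h))
      ≈⟨ +-congˡ (+-congˡ (halfTrace-artinSchreier n ((x ^ 2) ^ 2))) ⟩
    x + (x ^ 2 + absTrace (n ℕ.* 2) ((x ^ 2) ^ 2))
      ≈⟨ +-congˡ (absTrace-suc (n ℕ.* 2) (x ^ 2)) ⟨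
    x + absTrace (suc (n ℕ.* 2)) (x ^ 2)
      ≈⟨ absTrace-suc (suc (n ℕ.* 2)) x ⟨
    absTrace (suc n ℕ.* 2) x ∎
    where
    open Solver
    h = halfTrace n ((x ^ 2) ^ 2)

  -- Coordinates with respect to 1 and ε, the Tits form and a cube root of unity.

  module _ (ε : Carrier) (ε∉F : ¬ InSubfield q ε) (δ : Carrier) (δ∈F : InSubfield q δ)
           (ε-root : ε ^ 2 + ε + δ ≈ 0#) where

    ε≉0 : ε ≉ 0#
    ε≉0 ε≈0 = ε∉F (sub-cong (sym ε≈0) (0^ q {{ℕ.>-nonZero (ℕ.m^n>0 2 e)}}))

    -- Since δ lies in the subfield, ε^q is a root of the same quadratic as ε. Two roots differ by 0
    -- or 1, and difference 0 would put ε into the subfield.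
    ε^q : ε ^ q ≈ ε + 1#
    ε^q = x+y≈0⇒x≈y (trans (sym (+-assoc _ _ _)) (integral product≈0 (ε∉F ∘ x+y≈0⇒x≈y)))
      where
      conjugate-root : (ε ^ q) ^ 2 + ε ^ q + δ ≈ 0#
      conjugate-root = begin
        (ε ^ q) ^ 2 + ε ^ q + δ        ≈⟨ +-cong (+-congʳ (^-comm ε q 2)) (sym δ∈F) ⟩
        (ε ^ 2) ^ q + ε ^ q + δ ^ q    ≈⟨ trans (^q-+ _ _) (+-congʳ (^q-+ _ _)) ⟨
        (ε ^ 2 + ε + δ) ^ q            ≈⟨ ^-congˡ q ε-root ⟩
        0# ^ q                         ≈⟨ 0^ q {{ℕ.>-nonZero (ℕ.m^n>0 2 e)}} ⟩
        0#                             ∎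
      product≈0 : (ε ^ q + ε) * (ε ^ q + ε + 1#) ≈ 0#
      product≈0 = begin
        (ε ^ q + ε) * (ε ^ q + ε + 1#)
          ≈⟨ solve 3 (λ f x d → (f :+ x) :* (f :+ x :+ con true) :=
               (f :^ 2 :+ f :+ d) :+ (x :^ 2 :+ x :+ d)) refl (ε ^ q) ε δ ⟩
        ((ε ^ q) ^ 2 + ε ^ q + δ) + (ε ^ 2 + ε + δ)
          ≈⟨ +-cong conjugate-root ε-root ⟩
        0# + 0#
          ≈⟨ +-identityʳ 0# ⟩
        0# ∎
        where
        open Solver
  
    -- The relative trace of ε is 1, so v ↦ vε is a section of the trace onto the subfield. It
    -- supplies the last coordinate of an affine surface point over any given x₁ and x₂.
    trace-ε : ∀ {v} → InSubfield q v → (v * ε) ^ q + v * ε ≈ v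
    trace-ε {v} v∈F = begin
      (v * ε) ^ q + v * ε    ≈⟨ +-congʳ (trans (^q-* v ε) (*-cong v∈F ε^q)) ⟩
      v * (ε + 1#) + v * ε   ≈⟨ solve 2 (λ v x → v :* (x :+ con true) :+ v :* x := v) refl v ε ⟩
      v                      ∎
      where
      open Solver

    -- With x = s + t ε over the subfield, Γ is the form of the Suzuki–Tits
    -- ovoid.
    Γ-tits : ∀ {x s t} → x ^ q + x ≈ t → x + t * ε ≈ s →
      ΓK q σ ε x ≈ s ^ (σ ℕ.+ 2) + s * t + t ^ σ
    Γ-tits {x} {s} {t} t≈ s≈ = begin
      ΓK q σ ε x
        ≈⟨ +-congʳ (+-cong (+-congˡ (*-congʳ (+-congʳ (trans (sym (^-assocʳ x 2 q)) (^-comm x 2 q))))) (^-homo-* x q 1)) ⟩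
      (x + (x ^ q + x) * ε) ^ (σ ℕ.+ 2) + (x ^ q + x) ^ σ + ((x ^ q) ^ 2 + x ^ 2) * ε + x ^ q * x ^ 1 + x ^ 2
        ≈⟨ solve 5 (λ a b f x y → a :+ b :+ (f :^ 2 :+ x :^ 2) :* y :+ f :* x :^ 1 :+ x :^ 2 :=
             a :+ (x :+ (f :+ x) :* y) :* (f :+ x) :+ b) refl _ _ (x ^ q) x ε ⟩
      (x + (x ^ q + x) * ε) ^ (σ ℕ.+ 2) + (x + (x ^ q + x) * ε) * (x ^ q + x) + (x ^ q + x) ^ σ
        ≈⟨ +-cong (+-cong (^-congˡ (σ ℕ.+ 2) s≈′) (*-cong s≈′ t≈)) (^-congˡ σ t≈) ⟩
      s ^ (σ ℕ.+ 2) + s * t + t ^ σ ∎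
      where
      open Solver
      s≈′ = trans (+-congˡ (*-congʳ t≈)) s≈

    -- The Tits form has coefficients in the prime field, and both coordinates of x with respect to
    -- 1 and ε are fixed by the q-power map.
    Γ∈F : ∀ x → InSubfield q (ΓK q σ ε x)
    Γ∈F x = sub-cong (sym (Γ-tits refl refl))
      (sub-+ (sub-+ (sub-^ (σ ℕ.+ 2) s∈F) (sub-* s∈F (sub-trace x))) (sub-^ σ (sub-trace x)))
      where
      open Solver
      s∈F : InSubfield q (x + (x ^ q + x) * ε)
      s∈F = begin
        (x + (x ^ q + x) * ε) ^ q
          ≈⟨ trans (^q-+ _ _) (+-congˡ (trans (^q-* _ _) (*-cong (sub-trace x) ε^q))) ⟩
        x ^ q + (x ^ q + x) * (ε + 1#)
          ≈⟨ solve 3 (λ f x y → f :+ (f :+ x) :* (y :+ con true) := x :+ (f :+ x) :* y) refl (x ^ q) x ε ⟩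
        x + (x ^ q + x) * ε ∎

    -- For x₁ = s + t ε, choosing s = Tr(α ε) cancels the mixed term s t against
    -- the linear term in t, and t ↦ t^σ is onto the subfield.
    graph-meets : ∀ α γ {g} → InSubfield q g →
      ∃[ x ] (γ + α * x) ^ q + (γ + α * x) ≈ ΓK q σ ε x + g
    graph-meets α γ {g} g∈F = s + t * ε , (begin
      (γ + α * (s + t * ε)) ^ q + (γ + α * (s + t * ε))
        ≈⟨ +-congʳ (trans (^q-+ _ _) (+-congˡ (trans (^q-* _ _) (*-congˡ ^q-x)))) ⟩
      (γ ^ q + α ^ q * (s + t * ε ^ q)) + (γ + α * (s + t * ε))
        ≈⟨ solve 8 (λ c c' a a' s t y y' → (c' :+ a' :* (s :+ t :* y')) :+ (c :+ a :* (s :+ t :* y)) :=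
             (c' :+ c) :+ s :* (a' :+ a) :+ t :* (a' :* y' :+ a :* y)) refl γ (γ ^ q) α (α ^ q) s t ε (ε ^ q) ⟩
      (γ ^ q + γ) + s * (α ^ q + α) + t * (α ^ q * ε ^ q + α * ε)
        ≈⟨ +-congˡ (*-congˡ (+-congʳ (^q-* α ε))) ⟨
      (γ ^ q + γ) + s * (α ^ q + α) + t * s
        ≈⟨ solve 6 (λ c a s t g p → c :+ s :* a :+ t :* s :=
             p :+ s :* t :+ (g :+ c :+ s :* a :+ p) :+ g) refl (γ ^ q + γ) (α ^ q + α) s t g (s ^ (σ ℕ.+ 2)) ⟩
      s ^ (σ ℕ.+ 2) + s * t + v + g
        ≈⟨ +-congʳ (+-congˡ t^σ) ⟨
      s ^ (σ ℕ.+ 2) + s * t + t ^ σ + g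
        ≈⟨ +-congʳ (Γ-tits t≈ s≈) ⟨
      ΓK q σ ε (s + t * ε) + g ∎)
      where
      open Solver
      s = (α * ε) ^ q + α * ε
      -- The value that t^σ must take once the two terms in st cancel. It lies in the subfield,
      -- where the power `τ` extracts its σ-th root.
      v = g + (γ ^ q + γ) + s * (α ^ q + α) + s ^ (σ ℕ.+ 2)
      t = v ^ τ
      s∈F : InSubfield q s
      s∈F = sub-trace (α * ε)
      v∈F : InSubfield q v
      v∈F = sub-+ (sub-+ (sub-+ g∈F (sub-trace γ)) (sub-* s∈F (sub-trace α))) (sub-^ (σ ℕ.+ 2) s∈F)
      t^σ : t ^ σ ≈ v
      t^σ = trans (^-assocʳ v τ σ) (trans (^-congʳ v τσ≡q) v∈F)
      ^q-x : (s + t * ε) ^ q ≈ s + t * ε ^ q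
      ^q-x = trans (^q-+ _ _) (+-cong s∈F (trans (^q-* _ _) (*-congʳ (sub-^ τ v∈F))))
      t≈ : (s + t * ε) ^ q + (s + t * ε) ≈ t
      t≈ = begin
        (s + t * ε) ^ q + (s + t * ε)        ≈⟨ +-congʳ (trans ^q-x (+-congˡ (*-congˡ ε^q))) ⟩
        (s + t * (ε + 1#)) + (s + t * ε)     ≈⟨ solve 3 (λ s t y → (s :+ t :* (y :+ con true)) :+ (s :+ t :* y) := t) refl s t ε ⟩
        t                                    ∎
      s≈ : (s + t * ε) + t * ε ≈ s
      s≈ = solve 3 (λ s t y → (s :+ t :* y) :+ t :* y := s) refl s t ε

    -- ω = ε + (δ + δ⁴ + δ¹⁶ + …) solves ω² + ω = 1 because e is odd and δ has
    -- trace 1.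
    module CubeRoot (trace-δ : absTrace e δ ≈ 1#) where
      private
        H = halfTrace (suc (e / 2)) δ
      ω : Carrier
      ω = ε + H

      -- The half-trace has (e + 1)/2 terms, so H² + H sums e + 1 conjugates of δ: first δ itself,
      -- then the e conjugates of δ², whose sum is the square of the trace of δ.
      H-equation : H ^ 2 + H ≈ δ + 1#
      H-equation = begin
        H ^ 2 + H                  ≈⟨ halfTrace-artinSchreier (suc (e / 2)) δ ⟩
        absTrace (suc (e / 2) ℕ.* 2) δ ≈⟨ reflexive (≡.cong (λ n → absTrace (suc n) δ) (odd-form e e-odd)) ⟨
        absTrace (suc e) δ         ≈⟨ absTrace-suc e δ ⟩
        δ + absTrace e (δ ^ 2)     ≈⟨ +-congˡ (trans (absTrace-square e δ) (trans (^-congˡ 2 trace-δ) (1^ 2))) ⟩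
        δ + 1#                     ∎

      ω-equation : ω ^ 2 + ω ≈ 1#
      ω-equation = begin
        ω ^ 2 + ω ≈⟨ solve 3 (λ x h d → (x :+ h) :^ 2 :+ (x :+ h) :=
                       (x :^ 2 :+ x :+ d) :+ (h :^ 2 :+ h) :+ d) refl ε H δ ⟩
        (ε ^ 2 + ε + δ) + (H ^ 2 + H) + δ ≈⟨ +-congʳ (+-cong ε-root H-equation) ⟩
        0# + (δ + 1#) + δ         ≈⟨ solve 1 (λ d → con false :+ (d :+ con true) :+ d := con true) refl δ ⟩
        1#                        ∎
        where
        open Solver

      ω+1≉0 : ω + 1# ≉ 0#
      ω+1≉0 ω+1≈0 = 1≉0 (begin
        1#             ≈⟨ ω-equation ⟨
        ω ^ 2 + ω      ≈⟨ +-cong (trans (^-congˡ 2 (x+y≈0⇒x≈y ω+1≈0)) (1^ 2)) (x+y≈0⇒x≈y ω+1≈0) ⟩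
        1# + 1#        ≈⟨ 1+1≈0 ⟩
        0#             ∎)

      ω³≈1 : ω ^ 3 ≈ 1#
      ω³≈1 = begin
        ω ^ 3                          ≈⟨ solve 1 (λ w → w :^ 3 := w :* (w :^ 2 :+ w) :+ (w :^ 2 :+ w) :+ w) refl ω ⟩
        ω * (ω ^ 2 + ω) + (ω ^ 2 + ω) + ω ≈⟨ +-congʳ (+-cong (*-congˡ ω-equation) ω-equation) ⟩
        ω * 1# + 1# + ω                ≈⟨ solve 1 (λ w → w :* con true :+ con true :+ w := con true) refl ω ⟩
        1#                             ∎
        where
        open Solver
  
      ω^σ+2≈1 : e % 4 ≡ 3 → ω ^ (σ ℕ.+ 2) ≈ 1#
      ω^σ+2≈1 e≡3 with σ+2-mod-3-of-3 e e≡3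
      ... | w , σ+2≡ = trans (^-congʳ ω σ+2≡)
        (trans (sym (^-assocʳ ω 3 w)) (trans (^-congˡ w ω³≈1) (1^ w)))

-- Points of the surface at infinity and in the affine part.

module SurfaceCode (e : ℕ) (0<e : 0 ℕ.< e) (e-odd : e % 2 ≡ 1)
  (K : FiniteField c ℓ ((2 ℕ.^ e) ℕ.^ 2)) where
  open FiniteField K hiding (zero)
  open QuadraticExtension e e-odd K
  open HomogenizedVariety K using (Γʰ; homogenizedEquation; HasValue-affineEquation)
  open PolynomialProperties K using (homogenizeAt; degree-≡)
  open Polynomials K using (eval; homogenize; degree)
  open Projective K
  open Codes K
  open Variety K e
  open SetoidReasoning setoid

  Γʰ-infinite : ∀ ε {x₀ x} → x₀ ≈ 0# → Γʰ q σ ε x₀ x ≈ (x ^ q * ε) ^ (σ ℕ.+ 2)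
  Γʰ-infinite ε {x₀} {x} x₀≈0 = begin
    Γʰ q σ ε x₀ x
      ≈⟨ +-cong (+-cong (+-cong (+-cong
           (^-congˡ (σ ℕ.+ 2) (trans (+-cong (vanish _) (*-congʳ (trans (+-congˡ (vanish _)) (+-identityʳ _)))) (+-identityˡ _)))
           (vanish _)) (vanish _)) (vanish _)) (vanish _) ⟩
    (x ^ q * ε) ^ (σ ℕ.+ 2) + 0# + 0# + 0# + 0#
      ≈⟨ solve 1 (λ a → a :+ con false :+ con false :+ con false :+ con false := a) refl _ ⟩
    (x ^ q * ε) ^ (σ ℕ.+ 2) ∎
    where
    open Solver
    vanish : ∀ y → x₀ * y ≈ 0#
    vanish y = trans (*-congʳ x₀≈0) (zeroˡ y)

  Γʰ-affine : ∀ ε {x₀ x} → x₀ ≈ 1# → Γʰ q σ ε x₀ x ≈ ΓK q σ ε x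
  Γʰ-affine ε {x₀} {x} x₀≈1 =
    +-cong (+-cong (+-cong (+-cong
      (^-congˡ (σ ℕ.+ 2) (+-cong (unit _) (*-congʳ (+-congˡ (unit _)))))
      (trans (unit _) (^-congˡ σ (+-congˡ (unit _)))))
      (trans (unit _) (*-congʳ (+-congˡ (unit _))))) (unit _)) (unit _)
    where
    unit : ∀ y → x₀ * y ≈ y
    unit y = trans (*-congʳ x₀≈1) (*-identityˡ y)

  module _ (ε : Carrier) (ε≉0 : ε ≉ 0#) where

    private
      f = affineEquation 2 ε
      D = (σ ℕ.+ 2) ℕ.* q
      F = homogenizedEquation e 0<e 2 ε
      instance
        q-nonZero : ℕ.NonZero q
        q-nonZero = ℕ.>-nonZero (ℕ.m^n>0 2 e)
        σ+2-nonZero : ℕ.NonZero (σ ℕ.+ 2)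
        σ+2-nonZero = ℕ.>-nonZero (ℕ.<-≤-trans ℕ.z<s (ℕ.m≤n+m 2 σ))
      -- The homogeneous part of `Γ` of degree (σ + 2)q, the only part that remains where X₀ = 0.
      topForm : Carrier → Carrier
      topForm x = (x ^ q * ε) ^ (σ ℕ.+ 2)

    F-infinite : ∀ X → head X ≈ 0# → F X ≈ topForm (X 1F) + topForm (X 2F)
    F-infinite X X₀≈0 = begin
      F X  ≈⟨ +-cong (trans (*-congʳ X₀≈0) (zeroˡ _))
                (trans (-x≈x _) (+-cong (Γʰ-infinite ε X₀≈0) (+-congʳ (Γʰ-infinite ε X₀≈0)))) ⟩
      0# + (topForm (X 1F) + (topForm (X 2F) + 0#))
           ≈⟨ trans (+-identityˡ _) (+-congˡ (+-identityʳ _)) ⟩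
      topForm (X 1F) + topForm (X 2F) ∎

    F-affine : ∀ X → head X ≈ 1# →
      F X ≈ (X 3F ^ q + X 3F) + (ΓK q σ ε (X 1F) + ΓK q σ ε (X 2F))
    F-affine X X₀≈1 = +-cong (trans (unit _) (+-congˡ (unit _)))
      (trans (-x≈x _) (+-cong (Γʰ-affine ε X₀≈1) (trans (+-congʳ (Γʰ-affine ε X₀≈1)) (+-identityʳ _))))
      where
      unit : ∀ y → head X * y ≈ y
      unit y = trans (*-congʳ X₀≈1) (*-identityˡ y)

    -- At (0 : 1 : 0 : 0) the form of degree D takes the value ε^(σ+2), which is nonzero, so
    -- `degree-≡` applies. This identifies the degree in which `homogenize` works.
    degree-affineEquation : degree f ≡ D
    degree-affineEquation = degree-≡ D f (proj₁ value) λ eval≈0 → top≉0 (begin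
      topForm 1#               ≈⟨ +-identityʳ _ ⟨
      topForm 1# + 0#          ≈⟨ +-congˡ topForm-0 ⟨
      topForm 1# + topForm 0#  ≈⟨ F-infinite X refl ⟨
      F X                      ≈⟨ proj₂ value ⟨
      eval (homogenizeAt D f) X ≈⟨ eval≈0 ⟩
      0#                       ∎)
      where
      X : Vector Carrier 4
      X = 0# Vector.∷ (1# Vector.∷ 𝟎)
      value = HasValue-affineEquation e 0<e 2 ε X (zeroˡ 0#)
      top≉0 : topForm 1# ≉ 0#
      top≉0 = ^-nonzero (σ ℕ.+ 2) (*-nonzero (^-nonzero q 1≉0) ε≉0)
      topForm-0 : topForm 0# ≈ 0#
      topForm-0 = trans (^-congˡ (σ ℕ.+ 2) (trans (*-congʳ (0^ q)) (zeroˡ ε))) (0^ (σ ℕ.+ 2))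

    equation-value : ∀ X → head X * head X ≈ head X → eval (homogenize f) X ≈ F X
    equation-value X idem = trans
      (reflexive (≡.cong (λ D → eval (homogenizeAt D f) X) degree-affineEquation))
      (proj₂ (HasValue-affineEquation e 0<e 2 ε X idem))

    infinite-topForm : ∀ Q → 𝒱 2 ε Q → coords Q 0F ≈ 0# →
      (coords Q 1F ^ q * ε) ^ (σ ℕ.+ 2) ≈ (coords Q 2F ^ q * ε) ^ (σ ℕ.+ 2)
    infinite-topForm Q Q∈𝒱 Q₀≈0 = x+y≈0⇒x≈y (begin
      topForm (X 1F) + topForm (X 2F)  ≈⟨ F-infinite X Q₀≈0 ⟨
      F X                              ≈⟨ equation-value X (trans (*-congʳ Q₀≈0) (trans (zeroˡ _) (sym Q₀≈0))) ⟨
      eval (homogenize f) X            ≈⟨ Q∈𝒱 ⟩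
      0#                               ∎)
      where X = coords Q

    infinitePoint : (x y z : Carrier) → ¬ (x ≈ 0# × y ≈ 0# × z ≈ 0#) → Point 3
    infinitePoint x y z ≢0 = record
      { coords  = 0# Vector.∷ x Vector.∷ y Vector.∷ z Vector.∷ Vector.[]
      ; nonzero = λ X≋𝟎 → ≢0 (X≋𝟎 1F , X≋𝟎 2F , X≋𝟎 3F)
      }

    infinitePoint∈𝒱 : ∀ x y z ≢0 → x ^ (σ ℕ.+ 2) ≈ y ^ (σ ℕ.+ 2) → 𝒱 2 ε (infinitePoint x y z ≢0)
    infinitePoint∈𝒱 x y z ≢0 eq = trans (equation-value X (zeroˡ 0#)) (trans (F-infinite X refl)
      (trans (+-congʳ topForm-≈) (x+x≈0 _)))
      where
      X = coords (infinitePoint x y z ≢0)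
      topForm-≈ : topForm x ≈ topForm y
      topForm-≈ = begin
        topForm x                                    ≈⟨ ^-distrib-* _ _ (σ ℕ.+ 2) ⟩
        (x ^ q) ^ (σ ℕ.+ 2) * ε ^ (σ ℕ.+ 2)       ≈⟨ *-congʳ (trans (^-comm x q (σ ℕ.+ 2))
                                                          (trans (^-congˡ q eq) (^-comm y (σ ℕ.+ 2) q))) ⟩
        (y ^ q) ^ (σ ℕ.+ 2) * ε ^ (σ ℕ.+ 2)       ≈⟨ ^-distrib-* _ _ (σ ℕ.+ 2) ⟨
        topForm y                                    ∎

    affinePoint : (x y z : Carrier) → Point 3
    affinePoint x y z = record
      { coords  = 1# Vector.∷ x Vector.∷ y Vector.∷ z Vector.∷ Vector.[]
      ; nonzero = λ X≋𝟎 → 1≉0 (X≋𝟎 0F)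
      }

    affinePoint∈𝒱 : ∀ x y z → z ^ q + z ≈ ΓK q σ ε x + ΓK q σ ε y → 𝒱 2 ε (affinePoint x y z)
    affinePoint∈𝒱 x y z eq = trans (equation-value X (*-identityˡ 1#)) (trans (F-affine X refl)
      (trans (+-congʳ eq) (x+x≈0 _)))
      where X = coords (affinePoint x y z)

  -- Linear forms, hyperplane sections and minimal codes.

  dot : ∀ {n} → Vector Carrier n → Vector Carrier n → Carrier
  dot a X = sum (λ i → a i * X i)

  dot-cong : ∀ {n} (a : Vector Carrier n) {X Y} → X ≋ Y → dot a X ≈ dot a Y
  dot-cong {zero}  a X≋Y = refl
  dot-cong {suc n} a X≋Y = +-cong (*-congˡ (X≋Y zero)) (dot-cong (tail a) (X≋Y ∘ suc))

  dot-• : ∀ {n} (a : Vector Carrier n) s X → dot a (s • X) ≈ s * dot a X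
  dot-• {zero}  a s X = sym (zeroʳ s)
  dot-• {suc n} a s X = trans
    (+-cong (solve 3 (λ a s x → a :* (s :* x) := s :* (a :* x)) refl (head a) s (head X))
            (dot-• (tail a) s (tail X)))
    (sym (distribˡ _ _ _))
    where open Solver

  dot-+• : ∀ {n} (a b : Vector Carrier n) s X → dot (λ i → b i + s * a i) X ≈ dot b X + s * dot a X
  dot-+• {zero}  a b s X = sym (trans (+-identityˡ _) (zeroʳ s))
  dot-+• {suc n} a b s X = trans (+-congˡ (dot-+• (tail a) (tail b) s (tail X)))
    (solve 6 (λ a b s x u v → (b :+ s :* a) :* x :+ (u :+ s :* v) :=
       (b :* x :+ u) :+ s :* (a :* x :+ v)) refl (head a) (head b) s (head X) _ _)
    where open Solver

  dot-zero : ∀ {n} {a : Vector Carrier n} X → a ≋ 𝟎 → dot a X ≈ 0#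
  dot-zero {zero}  X a≋𝟎 = refl
  dot-zero {suc n} X a≋𝟎 = trans (+-cong (trans (*-congʳ (a≋𝟎 zero)) (zeroˡ _)) (dot-zero (tail X) (a≋𝟎 ∘ suc)))
    (+-identityˡ 0#)

  -- Dual form of: Ω ∩ H spans H for every hyperplane H.
  Cuts : ∀ {r} → (Point r → Set ℓ) → Set _
  Cuts {r} Ω = ∀ (a b : Vector Carrier (suc r)) → a ≋̸ 𝟎 →
    (∀ Q → Ω Q → dot a (coords Q) ≈ 0# → dot b (coords Q) ≈ 0#) → ∃[ s ] b ≋ s • a

  -- Codewords are linear forms evaluated at the representatives. Inclusion of supports is reverse
  -- inclusion of zero sets, which extends from the representatives to all points of `Ω` by scaling;
  -- `Cuts` then makes the two forms proportional.
  cuts⇒minimal : ∀ {r N} {Ω : Point r → Set ℓ} {P : Fin N → Point r} →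
    Representatives Ω P → Cuts Ω → IsMinimalCode (pointCode P)
  cuts⇒minimal {Ω = Ω} {P} reps cuts w (a , w≋) w≋̸𝟎 w′ (b , w′≋) _ supp⊆ =
    s , λ j → begin
      w′ j                          ≈⟨ w′≋ j ⟩
      dot b (coords (P j))          ≈⟨ S.sum-cong-≋ (λ i → trans (*-congʳ {coords (P j) i} (b≋sa i)) (swap s (a i) _)) ⟩
      dot a (s • coords (P j))      ≈⟨ dot-• a s (coords (P j)) ⟩
      s * dot a (coords (P j))      ≈⟨ *-congˡ (w≋ j) ⟨
      s * w j                       ∎
    where
    open Representatives reps
    open Solver
    import Algebra.Properties.CommutativeMonoid.Sum +-commutativeMonoid as S
    swap : ∀ x y z → x * y * z ≈ y * (x * z)
    swap = solve 3 (λ x y z → x :* y :* z := y :* (x :* z)) refl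
    section : ∀ Q → Ω Q → dot a (coords Q) ≈ 0# → dot b (coords Q) ≈ 0#
    section Q Q∈Ω aQ≈0 with complete Q Q∈Ω
    ... | j , t , t≉0 , Q≋tP = begin
      dot b (coords Q)            ≈⟨ dot-cong b Q≋tP ⟩
      dot b (t • coords (P j))    ≈⟨ dot-• b t (coords (P j)) ⟩
      t * dot b (coords (P j))    ≈⟨ *-congˡ (trans (sym (w′≋ j)) w′j≈0) ⟩
      t * 0#                      ≈⟨ zeroʳ t ⟩
      0#                          ∎
      where
      wj≈0 : w j ≈ 0#
      wj≈0 = trans (w≋ j) (integral (trans (sym (dot-• a t (coords (P j)))) (trans (sym (dot-cong a Q≋tP)) aQ≈0)) t≉0)
      w′j≈0 : w′ j ≈ 0#
      w′j≈0 = decidable-stable (w′ j ≈? 0#) (λ w′j≉0 → supp⊆ w′j≉0 wj≈0)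
    proportional : ∃[ s ] b ≋ s • a
    proportional = cuts a b (λ a≋𝟎 → w≋̸𝟎 (λ j → trans (w≋ j) (dot-zero (coords (P j)) a≋𝟎))) section
    s = proj₁ proportional
    b≋sa = proj₂ proportional

  -- Clearing the i-th coordinate of b with a multiple of a keeps the form zero on the section, so
  -- only forms d with d i = 0 have to be shown to vanish.
  reduce-to-pivot : ∀ {r} {Ω : Point r → Set ℓ} (a : Vector Carrier (suc r)) i → a i ≉ 0# →
    (∀ d → d i ≈ 0# → (∀ Q → Ω Q → dot a (coords Q) ≈ 0# → dot d (coords Q) ≈ 0#) → d ≋ 𝟎) →
    ∀ b → (∀ Q → Ω Q → dot a (coords Q) ≈ 0# → dot b (coords Q) ≈ 0#) → ∃[ s ] b ≋ s • a
  reduce-to-pivot a i aᵢ≉0 vanishing b section = s ,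
    λ j → x+y≈0⇒x≈y (vanishing (λ j → b j + s * a j) pivot≈0 section′ j)
    where
    s = b i * inv aᵢ≉0
    pivot≈0 : b i + s * a i ≈ 0#
    pivot≈0 = trans (+-congˡ (trans (*-assoc _ _ _) (trans (*-congˡ (inv-inverseˡ aᵢ≉0)) (*-identityʳ _)))) (x+x≈0 _)
    section′ : ∀ Q → _ → dot a (coords Q) ≈ 0# → dot (λ j → b j + s * a j) (coords Q) ≈ 0#
    section′ Q Q∈Ω aQ≈0 = trans (dot-+• a b s (coords Q))
      (trans (+-cong (section Q Q∈Ω aQ≈0) (trans (*-congˡ aQ≈0) (zeroʳ s))) (+-identityˡ 0#))

  -- Plane sections of the surface.

  module _ (ε : Carrier) (ε∉F : ¬ InSubfield q ε) (δ : Carrier) (δ∈F : InSubfield q δ)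
           (ε-root : ε ^ 2 + ε + δ ≈ 0#) where
    private
      ε≠0 = ε≉0 ε ε∉F δ δ∈F ε-root


    Section : (a d : Vector Carrier 4) → Set _
    Section a d = ∀ Q → 𝒱 2 ε Q → dot a (coords Q) ≈ 0# → dot d (coords Q) ≈ 0#

    module _ (a d : Vector Carrier 4) (section : Section a d) where
      open Solver

      at-infinite : ∀ {x z} → x ^ (σ ℕ.+ 2) ≈ 1# →
        a 1F * x + a 2F + a 3F * z ≈ 0# → d 1F * x + d 2F + d 3F * z ≈ 0#
      at-infinite {x} {z} xᴺ≈1 aQ≈0 = trans (sym (expand d))
        (section (infinitePoint ε ε≠0 x 1# z 1-nonzero)
          (infinitePoint∈𝒱 ε ε≠0 x 1# z 1-nonzero (trans xᴺ≈1 (sym (1^ (σ ℕ.+ 2)))))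
          (trans (expand a) aQ≈0))
        where
        1-nonzero : ¬ (x ≈ 0# × 1# ≈ 0# × z ≈ 0#)
        1-nonzero (_ , 1≈0 , _) = 1≉0 1≈0
        expand : ∀ a → a 0F * 0# + (a 1F * x + (a 2F * 1# + (a 3F * z + 0#))) ≈ a 1F * x + a 2F + a 3F * z
        expand a = solve 6 (λ a b c d x z →
          a :* con false :+ (b :* x :+ (c :* con true :+ (d :* z :+ con false))) := b :* x :+ c :+ d :* z)
          refl (a 0F) (a 1F) (a 2F) (a 3F) x z

      at-affine : ∀ {x y z} → z ^ q + z ≈ ΓK q σ ε x + ΓK q σ ε y →
        a 0F + a 1F * x + a 2F * y + a 3F * z ≈ 0# → d 0F + d 1F * x + d 2F * y + d 3F * z ≈ 0#
      at-affine {x} {y} {z} eq aQ≈0 = trans (sym (expand d))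
        (section (affinePoint ε ε≠0 x y z) (affinePoint∈𝒱 ε ε≠0 x y z eq) (trans (expand a) aQ≈0))
        where
        expand : ∀ a → a 0F * 1# + (a 1F * x + (a 2F * y + (a 3F * z + 0#))) ≈ a 0F + a 1F * x + a 2F * y + a 3F * z
        expand a = solve 7 (λ a b c d x y z →
          a :* con true :+ (b :* x :+ (c :* y :+ (d :* z :+ con false))) := a :+ b :* x :+ c :* y :+ d :* z)
          refl (a 0F) (a 1F) (a 2F) (a 3F) x y z

      at-vertex : a 3F ≈ 0# → d 3F ≈ 0#
      at-vertex a₃≈0 = trans (sym (expand d))
        (section (infinitePoint ε ε≠0 0# 0# 1# 1-nonzero)
          (infinitePoint∈𝒱 ε ε≠0 0# 0# 1# 1-nonzero refl) (trans (expand a) a₃≈0))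
        where
        1-nonzero : ¬ (0# ≈ 0# × 0# ≈ 0# × 1# ≈ 0#)
        1-nonzero (_ , _ , 1≈0) = 1≉0 1≈0
        expand : ∀ a → a 0F * 0# + (a 1F * 0# + (a 2F * 0# + (a 3F * 1# + 0#))) ≈ a 3F
        expand a = solve 4 (λ a b c d →
          a :* con false :+ (b :* con false :+ (c :* con false :+ (d :* con true :+ con false))) := d)
          refl (a 0F) (a 1F) (a 2F) (a 3F)

    ≈0-*  : ∀ {x} y → x ≈ 0# → x * y ≈ 0#
    ≈0-* y x≈0 = trans (*-congʳ x≈0) (zeroˡ y)

    +-dropʳ : ∀ {x y} → y ≈ 0# → x + y ≈ 0# → x ≈ 0#
    +-dropʳ y≈0 x+y≈0 = trans (sym (trans (+-congˡ y≈0) (+-identityʳ _))) x+y≈0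

    trace-onto : ∀ x y → let v = ΓK q σ ε x + ΓK q σ ε y in (v * ε) ^ q + v * ε ≈ v
    trace-onto x y = trace-ε ε ε∉F δ δ∈F ε-root
      (sub-+ (Γ∈F ε ε∉F δ δ∈F ε-root x) (Γ∈F ε ε∉F δ δ∈F ε-root y))

    module _ (trace-δ : absTrace e δ ≈ 1#) (e≡3 : e % 4 ≡ 3) where
      open CubeRoot ε ε∉F δ δ∈F ε-root trace-δ

      -- The values at 1 and ω suffice: their sum is (ω + 1)u, and ω differs from 1.
      vanish-at-unity : ∀ {u v} → (∀ x → x ^ (σ ℕ.+ 2) ≈ 1# → u * x + v ≈ 0#) → u ≈ 0# × v ≈ 0#
      vanish-at-unity {u} {v} vanishes = u≈0 , (begin
        v                   ≈⟨ +-identityˡ v ⟨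
        0# + v              ≈⟨ +-congʳ (≈0-* 1# u≈0) ⟨
        u * 1# + v          ≈⟨ at-1 ⟩
        0#                  ∎)
        where
        open Solver
        at-1 : u * 1# + v ≈ 0#
        at-1 = vanishes 1# (1^ (σ ℕ.+ 2))
        u≈0 : u ≈ 0#
        u≈0 = integral (begin
          (ω + 1#) * u                     ≈⟨ solve 3 (λ w u v → (w :+ con true) :* u :=
                                                (u :* w :+ v) :+ (u :* con true :+ v)) refl ω u v ⟩
          (u * ω + v) + (u * 1# + v)       ≈⟨ +-cong (vanishes ω (ω^σ+2≈1 e≡3)) at-1 ⟩
          0# + 0#                          ≈⟨ +-identityʳ 0# ⟩
          0#                               ∎) ω+1≉0

      -- The plane misses (0 : 0 : 0 : 1), so it meets each line X₁ = xX₂ at infinity with x^(σ+2) =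
      -- 1 in a point, found by solving for X₃. These points give d₁ = d₂ = 0, and one affine point
      -- with x₂ = 0 then gives d₀ = 0.
      vanish-pivot-3 : ∀ a → a 3F ≉ 0# → ∀ d → d 3F ≈ 0# → Section a d → d ≋ 𝟎
      vanish-pivot-3 a a₃≉0 d d₃≈0 section = λ { 0F → d₀≈0 ; 1F → proj₁ d₁₂≈0 ; 2F → proj₂ d₁₂≈0 ; 3F → d₃≈0 }
        where
        open Solver
        i = inv a₃≉0
        a₃-solve : ∀ u → u + a 3F * (i * u) ≈ 0#
        a₃-solve u = trans (+-congˡ (trans (sym (*-assoc _ _ _)) (trans (*-congʳ (inv-inverseʳ a₃≉0)) (*-identityˡ u)))) (x+x≈0 u)
        d₁₂≈0 : d 1F ≈ 0# × d 2F ≈ 0#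
        d₁₂≈0 = vanish-at-unity λ x xᴺ≈1 → +-dropʳ (≈0-* _ d₃≈0) (at-infinite a d section xᴺ≈1 (a₃-solve _))
        -- On x₂ = 0 the plane is the graph z = γ + αx, without signs in characteristic two.
        α = i * a 1F
        γ = i * a 0F
        meets = graph-meets ε ε∉F δ δ∈F ε-root α γ (Γ∈F ε ε∉F δ δ∈F ε-root 0#)
        x = proj₁ meets
        d₀≈0 : d 0F ≈ 0#
        d₀≈0 = +-dropʳ (≈0-* x (proj₁ d₁₂≈0)) (+-dropʳ (≈0-* 0# (proj₂ d₁₂≈0)) (+-dropʳ (≈0-* _ d₃≈0)
          (at-affine a d section (proj₂ meets) (trans
            (solve 6 (λ a b c d i x → a :+ b :* x :+ c :* con false :+ d :* (i :* a :+ i :* b :* x) :=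
              (a :+ b :* x) :+ d :* (i :* (a :+ b :* x))) refl (a 0F) (a 1F) (a 2F) (a 3F) i x)
            (a₃-solve (a 0F + a 1F * x))))))

      -- The plane contains (0 : 0 : 0 : 1), which gives d₃ = 0. It also contains an affine surface
      -- point for every value y of x₂, so d₀ + d₂y vanishes identically; y = 0 and y = 1 decide.
      vanish-pivot-1 : ∀ a → a 3F ≈ 0# → a 1F ≉ 0# → ∀ d → d 1F ≈ 0# → Section a d → d ≋ 𝟎
      vanish-pivot-1 a a₃≈0 a₁≉0 d d₁≈0 section = λ { 0F → d₀≈0 ; 1F → d₁≈0 ; 2F → d₂≈0 ; 3F → d₃≈0 }
        where
        open Solver
        i = inv a₁≉0
        d₃≈0 : d 3F ≈ 0#
        d₃≈0 = at-vertex a d section a₃≈0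
        line : ∀ y → d 0F + d 2F * y ≈ 0#
        line y = +-dropʳ (≈0-* x d₁≈0) (trans
          (solve 4 (λ a b c y → a :+ c :* y :+ b := a :+ b :+ c :* y) refl (d 0F) (d 1F * x) (d 2F) y)
          (+-dropʳ (≈0-* _ d₃≈0) (at-affine a d section (trace-onto x y) (begin
            a 0F + a 1F * x + a 2F * y + a 3F * z
              ≈⟨ +-cong (+-congʳ (+-congˡ (trans (sym (*-assoc _ _ _)) (trans (*-congʳ (inv-inverseʳ a₁≉0)) (*-identityˡ _))))) (≈0-* z a₃≈0) ⟩
            a 0F + (a 0F + a 2F * y) + a 2F * y + 0#
              ≈⟨ solve 3 (λ a c y → a :+ (a :+ c :* y) :+ c :* y :+ con false := con false) refl (a 0F) (a 2F) y ⟩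
            0# ∎))))
          where
          x = i * (a 0F + a 2F * y)
          -- A solution of the surface equation over x and y by `trace-ε`; its choice does not
          -- affect the plane equation, as a₃ = 0.
          z = (ΓK q σ ε x + ΓK q σ ε y) * ε
        d₀≈0 : d 0F ≈ 0#
        d₀≈0 = +-dropʳ (zeroʳ (d 2F)) (line 0#)
        d₂≈0 : d 2F ≈ 0#
        d₂≈0 = trans (sym (*-identityʳ _)) (+-dropʳ d₀≈0 (trans (+-comm _ _) (line 1#)))

      -- As for pivot 1, with the first two affine coordinates exchanged.
      vanish-pivot-2 : ∀ a → a 3F ≈ 0# → a 2F ≉ 0# → ∀ d → d 2F ≈ 0# → Section a d → d ≋ 𝟎
      vanish-pivot-2 a a₃≈0 a₂≉0 d d₂≈0 section = λ { 0F → d₀≈0 ; 1F → d₁≈0 ; 2F → d₂≈0 ; 3F → d₃≈0 }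
        where
        open Solver
        i = inv a₂≉0
        d₃≈0 : d 3F ≈ 0#
        d₃≈0 = at-vertex a d section a₃≈0
        line : ∀ x → d 0F + d 1F * x ≈ 0#
        line x = +-dropʳ (≈0-* y d₂≈0)
          (+-dropʳ (≈0-* _ d₃≈0) (at-affine a d section (trace-onto x y) (begin
            a 0F + a 1F * x + a 2F * y + a 3F * z
              ≈⟨ +-cong (+-congˡ (trans (sym (*-assoc _ _ _)) (trans (*-congʳ (inv-inverseʳ a₂≉0)) (*-identityˡ _)))) (≈0-* z a₃≈0) ⟩
            a 0F + a 1F * x + (a 0F + a 1F * x) + 0#
              ≈⟨ solve 3 (λ a b x → a :+ b :* x :+ (a :+ b :* x) :+ con false := con false) refl (a 0F) (a 1F) x ⟩
            0# ∎)))
          where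
          y = i * (a 0F + a 1F * x)
          z = (ΓK q σ ε x + ΓK q σ ε y) * ε
        d₀≈0 : d 0F ≈ 0#
        d₀≈0 = +-dropʳ (zeroʳ (d 1F)) (line 0#)
        d₁≈0 : d 1F ≈ 0#
        d₁≈0 = trans (sym (*-identityʳ _)) (+-dropʳ d₀≈0 (trans (+-comm _ _) (line 1#)))

      -- The plane is Π∞, and it is spanned by the surface points (0 : 1 : 1 : 0), (0 : ω : 1 : 0)
      -- and (0 : 0 : 0 : 1).
      vanish-pivot-0 : ∀ a → a 3F ≈ 0# → a 1F ≈ 0# → a 2F ≈ 0# →
        ∀ d → d 0F ≈ 0# → Section a d → d ≋ 𝟎
      vanish-pivot-0 a a₃≈0 a₁≈0 a₂≈0 d d₀≈0 section =
        λ { 0F → d₀≈0 ; 1F → proj₁ d₁₂≈0 ; 2F → proj₂ d₁₂≈0 ; 3F → at-vertex a d section a₃≈0 }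
        where
        d₁₂≈0 : d 1F ≈ 0# × d 2F ≈ 0#
        d₁₂≈0 = vanish-at-unity λ x xᴺ≈1 → +-dropʳ (zeroʳ (d 3F)) (at-infinite a d section xᴺ≈1
          (trans (+-cong (trans (+-cong (≈0-* x a₁≈0) a₂≈0) (+-identityʳ 0#)) (zeroʳ (a 3F))) (+-identityʳ 0#)))

      surface-cuts : Cuts (𝒱 2 ε)
      surface-cuts a b a≋̸𝟎 section with a 3F ≈? 0# | a 1F ≈? 0# | a 2F ≈? 0#
      ... | no  a₃≉0 | _        | _        = reduce-to-pivot a 3F a₃≉0 (vanish-pivot-3 a a₃≉0) b section
      ... | yes a₃≈0 | no  a₁≉0 | _        = reduce-to-pivot a 1F a₁≉0 (vanish-pivot-1 a a₃≈0 a₁≉0) b section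
      ... | yes a₃≈0 | yes a₁≈0 | no  a₂≉0 = reduce-to-pivot a 2F a₂≉0 (vanish-pivot-2 a a₃≈0 a₂≉0) b section
      ... | yes a₃≈0 | yes a₁≈0 | yes a₂≈0 = reduce-to-pivot a 0F a₀≉0 (vanish-pivot-0 a a₃≈0 a₁≈0 a₂≈0) b section
        where
        a₀≉0 : a 0F ≉ 0#
        a₀≉0 a₀≈0 = a≋̸𝟎 λ { 0F → a₀≈0 ; 1F → a₁≈0 ; 2F → a₂≈0 ; 3F → a₃≈0 }

    -- From the equality of top forms the exponent σ + 2, the factor ε and the q-power map are
    -- cancelled in turn, each being injective.
    infinite-plane-section : e % 4 ≡ 1 → ∀ Q → 𝒱 2 ε Q → coords Q 0F ≈ 0# → coords Q 1F ≈ coords Q 2F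
    infinite-plane-section e≡1 Q Q∈𝒱 Q₀≈0 = ^q-injective (*-cancelˡ ε≠0
      (trans (*-comm _ _) (trans (^σ+2-injective e≡1 (infinite-topForm ε ε≠0 Q Q∈𝒱 Q₀≈0)) (*-comm _ _))))

    -- The word X₁ + X₂ vanishes wherever X₀ does.
    not-minimal : e % 4 ≡ 1 → ∀ {N} {P : Fin N → Point 3} → Representatives (𝒱 2 ε) P →
      ¬ IsMinimalCode (pointCode P)
    not-minimal e≡1 {N} {P} reps minimal = word-nonzero b 1# dot-b-1 w′≋𝟎
      where
      open Representatives reps
      open Solver
      a b : Vector Carrier 4
      a = 1# Vector.∷ 0# Vector.∷ 0# Vector.∷ 0# Vector.∷ Vector.[]
      b = 0# Vector.∷ 1# Vector.∷ 1# Vector.∷ 0# Vector.∷ Vector.[]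
      word : Vector Carrier 4 → Vector Carrier N
      word a j = dot a (coords (P j))
      dot-a : ∀ X → dot a X ≈ X 0F
      dot-a X = solve 4 (λ x y z t → con true :* x :+ (con false :* y :+ (con false :* z :+ (con false :* t :+ con false))) := x)
        refl (X 0F) (X 1F) (X 2F) (X 3F)
      dot-b : ∀ X → dot b X ≈ X 1F + X 2F
      dot-b X = solve 4 (λ x y z t → con false :* x :+ (con true :* y :+ (con true :* z :+ (con false :* t :+ con false))) := y :+ z)
        refl (X 0F) (X 1F) (X 2F) (X 3F)
      -- Two of these points decide: at `Q 1#` the form X₁ + X₂ is 1, so its word is nonzero, while
      -- at `Q 0#` it is 0 and X₀ is 1, which forces the proportionality factor to be 0.
      Q : Carrier → Point 3
      Q x = affinePoint ε ε≠0 x 0# ((ΓK q σ ε x + ΓK q σ ε 0#) * ε)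
      dot-b-1 : dot b (coords (Q 1#)) ≈ 1#
      dot-b-1 = trans (dot-b (coords (Q 1#))) (+-identityʳ 1#)
      represented : ∀ x → ∃[ j ] Q x ∼ P j
      represented x = complete (Q x) (affinePoint∈𝒱 ε ε≠0 x 0# _ (trace-onto x 0#))
      value-at : ∀ a x → dot a (coords (Q x)) ≈ proj₁ (proj₂ (represented x)) * word a (proj₁ (represented x))
      value-at a x = trans (dot-cong a (proj₂ (proj₂ (proj₂ (represented x))))) (dot-• a (proj₁ (proj₂ (represented x))) (coords (P (proj₁ (represented x)))))
      word-nonzero : ∀ a x → dot a (coords (Q x)) ≈ 1# → word a ≋̸ 𝟎
      word-nonzero a x aQ≈1 w≋𝟎 = 1≉0 (trans (sym aQ≈1) (trans (value-at a x) (trans (*-congˡ (w≋𝟎 _)) (zeroʳ _))))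
      supp⊆ : ∀ {j} → word b j ≉ 0# → word a j ≉ 0#
      supp⊆ {j} w′j≉0 wj≈0 = w′j≉0 (trans (dot-b X) (trans (+-congʳ X₁≈X₂) (x+x≈0 _)))
        where
        X = coords (P j)
        X₁≈X₂ : X 1F ≈ X 2F
        X₁≈X₂ = infinite-plane-section e≡1 (P j) (sound j) (trans (sym (dot-a X)) wj≈0)
      proportional : ∃[ s ] word b ≋ s • word a
      proportional = minimal (word a) (a , λ j → refl) (word-nonzero a 0# (dot-a (coords (Q 0#))))
        (word b) (b , λ j → refl) (word-nonzero b 1# dot-b-1) supp⊆
      s = proj₁ proportional
      s≈0 : s ≈ 0#
      s≈0 = begin
        s                                ≈⟨ *-identityʳ s ⟨
        s * 1#                           ≈⟨ *-congˡ (trans (sym (dot-a (coords (Q 0#)))) (value-at a 0#)) ⟩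
        s * (t * word a j)               ≈⟨ solve 3 (λ s t w → s :* (t :* w) := t :* (s :* w)) refl s t (word a j) ⟩
        t * (s * word a j)               ≈⟨ *-congˡ (proj₂ proportional j) ⟨
        t * word b j                     ≈⟨ value-at b 0# ⟨
        dot b (coords (Q 0#))            ≈⟨ dot-b (coords (Q 0#)) ⟩
        0# + 0#                          ≈⟨ +-identityʳ 0# ⟩
        0#                               ∎
        where
        j = proj₁ (represented 0#)
        t = proj₁ (proj₂ (represented 0#))
      w′≋𝟎 : word b ≋ 𝟎
      w′≋𝟎 j = trans (proj₂ proportional j) (≈0-* _ s≈0)

-- The two directions, according to the residue of e modulo 4.

open import Data.Nat.Base using (_≤_; _^_)

theorem3p5 : ∀ {c ℓ} (e : ℕ) → 3 ≤ e → e % 2 ≡ 1 →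
    (K : FiniteField c ℓ ((2 ^ e) ^ 2)) →
    let q = 2 ^ e
        module K = FiniteField K
        open Projective K
        open Codes K
        open Variety K e
    in
    (ε : K.Carrier) → ¬ K.InSubfield q ε →
    (δ : K.Carrier) → K.InSubfield q δ → δ K.≉ K.1# → K.absTrace e δ K.≈ K.1# →
    (ε K.^ 2) K.+ ε K.+ δ K.≈ K.0# →
    (N : ℕ) (P : Fin N → Point 3) → Representatives (𝒱 2 ε) P →
    IsMinimalCode (pointCode P) ⇔ (e % 4 ≡ 3)
theorem3p5 e 3≤e e-odd K ε ε∉F δ δ∈F _ trace-δ ε-root N P reps = mk⇔ forward backward
  where
  open Codes K
  open SurfaceCode e (ℕ.≤-trans (ℕ.s≤s ℕ.z≤n) 3≤e) e-odd K
  forward : IsMinimalCode (pointCode P) → e % 4 ≡ 3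
  forward minimal with odd-mod-4 e e-odd
  ... | inj₁ e≡1 = contradiction minimal (not-minimal ε ε∉F δ δ∈F ε-root e≡1 reps)
  ... | inj₂ e≡3 = e≡3
  backward : e % 4 ≡ 3 → IsMinimalCode (pointCode P)
  backward e≡3 = cuts⇒minimal reps (surface-cuts ε ε∉F δ δ∈F ε-root trace-δ e≡3)
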